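{- For every positive integer $n$, the number of permutations of $[n]$ having a positive up-down sequence is $[(n-1)!!]^2$ if $n$ is even and $n!!\,(n-2)!!$ if $n$ is odd. The number of permutations of $[n]$ having a Dyck up-down sequence is $(n-1)!!\,(n-3)!!$ if $n$ is even and $0$ if $n$ is odd.
   Context: For a permutation $\sigma=\sigma_1\ldots\sigma_n$ of $[n]=\{1,\ldots,n\}$, an ascent is an index $i<n$ with $\sigma_i<\sigma_{i+1}$ and a descent is an index $i<n$ with $\sigma_i>\sigma_{i+1}$. The permutation has a positive up-down sequence if for all $j\le n$ the number of ascents less than $j$ is at most the number of descents less than $j$. It has a Dyck up-down sequence if it has exactly one more ascent than descents but for all $j<n$ the number of ascents less than $j$ is at most the number of descents less than $j$. Double factorials: $m!!=m(m-2)(m-4)\cdots$ down to $1$ or $2$ for $m\ge1$, with the convention $0!!=(-1)!!=1$. -}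

module Defs where

open import Data.Fin.Base using (Fin; suc; toℕ; inject₁; _<_; _>_)
open import Data.Fin.Permutation using (Permutation′; _⟨$⟩ʳ_; _≈_)
open import Data.Fin.Properties using (_<?_)
open import Data.Integer.Base using (ℤ; +_; -[1+_])
open import Data.Nat.Base as ℕ using (ℕ; zero; suc; _*_; _≤_)
open import Data.Nat.Properties as ℕₚ using ()
open import Data.Product.Base using (Σ; _×_; proj₁)
open import Data.Vec.Base using (allFin; count)
open import Function.Bundles using (Inverse)
open import Level using (0ℓ)
open import Relation.Binary.Bundles using (Setoid)
open import Relation.Binary.Construct.On as On using ()
open import Relation.Binary.PropositionalEquality using (_≡_; refl; sym; trans; setoid)
open import Relation.Nullary.Decidable using (_×-dec_)
open import Relation.Unary using (Pred; Decidable)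

-- Positions and values of [n] are shifted down by one: the element k of [n]
-- is the element of Fin n with toℕ equal to k ∸ 1.  With n = suc m, the
-- indices i < n of adjacent pairs (σ_i , σ_{i+1}) form Fin m.

Ascent : ∀ {m} → Permutation′ (suc m) → Pred (Fin m) 0ℓ
Ascent σ i = σ ⟨$⟩ʳ inject₁ i < σ ⟨$⟩ʳ suc i

Descent : ∀ {m} → Permutation′ (suc m) → Pred (Fin m) 0ℓ
Descent σ i = σ ⟨$⟩ʳ inject₁ i > σ ⟨$⟩ʳ suc i

ascent? : ∀ {m} (σ : Permutation′ (suc m)) → Decidable (Ascent σ)
ascent? σ i = σ ⟨$⟩ʳ inject₁ i <? σ ⟨$⟩ʳ suc i

descent? : ∀ {m} (σ : Permutation′ (suc m)) → Decidable (Descent σ)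
descent? σ i = σ ⟨$⟩ʳ suc i <? σ ⟨$⟩ʳ inject₁ i

#ascents : ∀ {m} → Permutation′ (suc m) → ℕ
#ascents {m} σ = count (ascent? σ) (allFin m)

#descents : ∀ {m} → Permutation′ (suc m) → ℕ
#descents {m} σ = count (descent? σ) (allFin m)

-- The bound j refers to indices starting at 1, hence suc (toℕ i).

#ascents<_ : ∀ {m} → ℕ → Permutation′ (suc m) → ℕ
(#ascents<_) {m} j σ = count (λ i → suc (toℕ i) ℕₚ.<? j ×-dec ascent? σ i) (allFin m)

#descents<_ : ∀ {m} → ℕ → Permutation′ (suc m) → ℕ
(#descents<_) {m} j σ = count (λ i → suc (toℕ i) ℕₚ.<? j ×-dec descent? σ i) (allFin m)

PositiveUpDown : ∀ {m} → Pred (Permutation′ (suc m)) 0ℓ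
PositiveUpDown {m} σ = ∀ j → j ≤ suc m → (#ascents< j) σ ≤ (#descents< j) σ

DyckUpDown : ∀ {m} → Pred (Permutation′ (suc m)) 0ℓ
DyckUpDown {m} σ = #ascents σ ≡ suc (#descents σ)
                 × (∀ j → j ℕ.< suc m → (#ascents< j) σ ≤ (#descents< j) σ)

permutationSetoid : ℕ → Setoid 0ℓ 0ℓ
permutationSetoid n = record
  { Carrier       = Permutation′ n
  ; _≈_           = _≈_
  ; isEquivalence = record
    { refl  = λ _ → refl
    ; sym   = λ p i → sym (p i)
    ; trans = λ p q i → trans (p i) (q i)
    }
  }

-- Equality of members only compares the permutations, not the proofs of P.

PermutationsWith : ∀ {n} → Pred (Permutation′ n) 0ℓ → Setoid 0ℓ 0ℓ
PermutationsWith {n} P =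
  On.setoid {B = Σ (Permutation′ n) P} (permutationSetoid n) proj₁

NumberOfPermutationsWith_Is_ : ∀ {n} → Pred (Permutation′ n) 0ℓ → ℕ → Set
NumberOfPermutationsWith P Is N = Inverse (PermutationsWith P) (setoid (Fin N))

-- Integer argument so that (-1)!! = 1 is literal; values below -1 are junk.

infix 9 _!!

_!! : ℤ → ℕ
(+ zero)          !! = 1
(+ suc zero)      !! = 1
(+ suc (suc m))   !! = suc (suc m) * (+ m) !!
-[1+ _ ]          !! = 1

{-# OPTIONS --safe #-}

-- Draw a permutation as a lattice path, an ascent being a step up and a descent a step down. Cut any
-- path at a maximum: the part after the cut is positive, and so is the reverse of the part before it.
-- Conversely two positive permutations of complementary sets of values, the first one reversed, are
-- glued by a descent (cut after the last maximum) or by an ascent (cut before the first maximum). So, if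
-- b n counts the positive permutations, Σ binom(n , i) (b i) (b (n − i)) = 2 n! for n ≥ 1, that is,
-- B² = (1 + x) / (1 − x) for the exponential generating function B, which determines b. A permutation
-- of [n] all of whose proper prefixes are positive is positive or Dyck, and these permutations arise
-- by adding a last value of any rank, so that n (b (n − 1)) = b n + d n for the Dyck numbers d.

module Submission where

open import Defs
open import Data.Bool.Base using (Bool; true; false; not; _∧_; if_then_else_)
open import Data.Bool.Properties using (∧-conicalˡ; ∧-conicalʳ; ¬-not; not-¬; not-involutive)
open import Data.Fin.Base using (Fin; toℕ; fromℕ; inject₁; punchIn; punchOut)
import Data.Fin.Base as Fin
open import Data.Fin.Permutation using (Permutation′; _⟨$⟩ʳ_; _≈_; remove; insert; insert-remove; remove-insert; punchIn-permute)
import Data.Fin.Permutation as Perm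
open import Data.Fin.Properties using (toℕ<n; toℕ-inject₁; toℕ-fromℕ; punchIn-injective; +↔⊎; _≟_)
import Data.Integer.Base as ℤ
open import Data.List.Base using (List; []; _∷_; _++_; length; replicate)
open import Data.List.Properties using (length-++; length-replicate; ++-assoc; ++-identityʳ)
open import Data.Nat.Base using (ℕ; zero; suc; pred; _+_; _*_; _∸_; _/_; _^_; _!; _≤_; _<_; z≤n; s≤s; s≤s⁻¹; _<ᵇ_; _≤ᵇ_)
open import Data.Nat.Combinatorics using (_C_; nCk+nC[k+1]≡[n+1]C[k+1]; nCk≡n!/k![n-k]!; k![n∸k]!∣n!; k>n⇒nCk≡0; nCn≡1)
open import Data.Nat.Divisibility using (_∣_; _∤_; divides)
open import Data.Nat.DivMod using (m/n*n≡m)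
open import Data.Nat.Induction using (<-rec)
open import Data.Nat.Properties hiding (_≟_)
open import Data.Nat.Solver using (module +-*-Solver)
open import Data.Product.Base using (Σ; _×_; _,_; proj₁; proj₂)
open import Data.Product.Function.Dependent.Propositional using (Σ-↔)
open import Data.Sum.Base using (_⊎_; inj₁; inj₂)
open import Data.Sum.Function.Propositional using (_⊎-↔_)
open import Data.Unit.Base using (⊤; tt)
open import Data.Vec.Base using (count; tabulate)
open import Function.Base using (_∘_; const; id)
open import Function.Bundles using (_↔_; _⇔_; mk⇔; mk↔ₛ′; Inverse; Equivalence)
open import Function.Construct.Composition using (_↔-∘_)
open import Function.Construct.Identity using (↔-id)
open import Function.Construct.Symmetry using (↔-sym)
open import Function.Related.TypeIsomorphisms using (Σ-assoc)
open import Level using (0ℓ)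
open import Relation.Binary.PropositionalEquality
open import Relation.Nullary.Decidable using (does; yes; no; _×-dec_)
open import Relation.Nullary.Negation using (contradiction)
open import Relation.Unary using (Pred; Decidable)
open import Algebra.Properties.Semiring.Sum +-*-semiring using (sum; sum-cong-≗; ∑-distrib-+; ∑-comm; *-distribˡ-sum; *-distribʳ-sum; sum-init-last)
open ≡-Reasoning
open +-*-Solver using (solve; _:=_; _:+_; _:*_; con)

-- The gluing rests on two facts about the number `perms w` of permutations with given steps: two
-- blocks are independent once the step between them is left open, and reversing a permutation
-- preserves the count. Bijections on relative orders are avoided by counting sequences of ranks,
-- each value being ranked among the values up to it. There the first fact is almost immediate,
-- since the weights of the two possible steps add up to a constant. But the ranks of a later block
-- refer to all earlier values, and rank sequences have no visible symmetry under reversal. Both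
-- obstacles yield to trading a descent for an ascent until only increasing runs remain, whose
-- counts are binomial coefficients. Identities with quotients are stated multiplied out by
-- factorials. Actual permutations enter only at the end, through their codes.

-- Counting permutations with given steps by sequences of ranks

data Step : Set where
  up down : Step

-- Words are read backwards: the head of a word is the last step of the permutation.
Word : Set
Word = List Step

𝟙 : Bool → ℕ
𝟙 true  = 1
𝟙 false = 0

∑< : ℕ → (ℕ → ℕ) → ℕ
∑< n F = sum {n} (F ∘ toℕ)

∑<-cong : ∀ n {F G : ℕ → ℕ} → F ≗ G → ∑< n F ≡ ∑< n G
∑<-cong n F≗G = sum-cong-≗ {n} (F≗G ∘ toℕ)

∑<-one : ∀ n → ∑< n (const 1) ≡ n
∑<-one zero    = refl
∑<-one (suc n) = cong suc (∑<-one n)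

∑<-zero : ∀ n → ∑< n (const 0) ≡ 0
∑<-zero zero    = refl
∑<-zero (suc n) = ∑<-zero n

-- Here s is the rank of the last value before the value of rank r is appended; appending it raises
-- that rank to suc s if r ≤ s.
follows : Step → ℕ → ℕ → ℕ
follows up   s r = 𝟙 (s <ᵇ r)
follows down s r = 𝟙 (not (s <ᵇ r))

follows-up+down : ∀ s r → follows up s r + follows down s r ≡ 1
follows-up+down s r with s <ᵇ r
... | true  = refl
... | false = refl

-- The number of sequences of ranks r₀ < N , r₁ < N + 1 , … that end in r and have the steps w, each
-- counted with weight F r₀.
byLastRank : ℕ → (ℕ → ℕ) → Word → ℕ → ℕ
byLastRank N F []      r = F r
byLastRank N F (x ∷ w) r = ∑< (length w + N) λ s → follows x s r * byLastRank N F w s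

allRanks : ℕ → (ℕ → ℕ) → Word → ℕ
allRanks N F w = ∑< (length w + N) (byLastRank N F w)

byLastRank-cong : ∀ N {F G} → F ≗ G → ∀ w → byLastRank N F w ≗ byLastRank N G w
byLastRank-cong N F≗G []      r = F≗G r
byLastRank-cong N F≗G (x ∷ w) r =
  ∑<-cong (length w + N) λ s → cong (follows x s r *_) (byLastRank-cong N F≗G w s)

byLastRank-+ : ∀ N F G w r → byLastRank N (λ s → F s + G s) w r ≡ byLastRank N F w r + byLastRank N G w r
byLastRank-+ N F G []      r = refl
byLastRank-+ N F G (x ∷ w) r = begin
  ∑< n (λ s → χ s * byLastRank N (λ s → F s + G s) w s)
    ≡⟨ ∑<-cong n (λ s → trans (cong (χ s *_) (byLastRank-+ N F G w s)) (*-distribˡ-+ (χ s) (byLastRank N F w s) (byLastRank N G w s))) ⟩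
  ∑< n (λ s → χ s * byLastRank N F w s + χ s * byLastRank N G w s)
    ≡⟨ ∑-distrib-+ {n} _ _ ⟩
  byLastRank N F (x ∷ w) r + byLastRank N G (x ∷ w) r ∎
  where
  n = length w + N
  χ = λ s → follows x s r

byLastRank-const : ∀ N a w r → byLastRank N (const a) w r ≡ a * byLastRank N (const 1) w r
byLastRank-const N a []      r = sym (*-identityʳ a)
byLastRank-const N a (x ∷ w) r = begin
  ∑< n (λ s → χ s * byLastRank N (const a) w s)
    ≡⟨ ∑<-cong n (λ s → trans (cong (χ s *_) (byLastRank-const N a w s)) (swap (χ s) a _)) ⟩
  ∑< n (λ s → a * (χ s * byLastRank N (const 1) w s))
    ≡⟨ *-distribˡ-sum {n} a _ ⟨
  a * byLastRank N (const 1) (x ∷ w) r ∎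
  where
  n = length w + N
  χ = λ s → follows x s r
  swap : ∀ x y z → x * (y * z) ≡ y * (x * z)
  swap = solve 3 (λ x y z → x :* (y :* z) := y :* (x :* z)) refl

length-+++ : ∀ (v u : Word) N → length (v ++ u) + N ≡ length v + (length u + N)
length-+++ v u N = trans (cong (_+ N) (length-++ v)) (+-assoc (length v) _ N)

-- The head of a word is its last step, so `u` comes before `v` and acts on it only through the
-- weight of the rank at which `v` starts.
byLastRank-++ : ∀ N F v u → byLastRank N F (v ++ u) ≗ byLastRank (length u + N) (byLastRank N F u) v
byLastRank-++ N F []      u r = refl
byLastRank-++ N F (x ∷ v) u r = begin
  ∑< (length (v ++ u) + N) (λ s → follows x s r * byLastRank N F (v ++ u) s)
    ≡⟨ cong (λ n → ∑< n (λ s → follows x s r * byLastRank N F (v ++ u) s)) (length-+++ v u N) ⟩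
  ∑< n (λ s → follows x s r * byLastRank N F (v ++ u) s)
    ≡⟨ ∑<-cong n (λ s → cong (follows x s r *_) (byLastRank-++ N F v u s)) ⟩
  byLastRank (length u + N) (byLastRank N F u) (x ∷ v) r ∎
  where n = length v + (length u + N)

allRanks-++ : ∀ N F v u → allRanks N F (v ++ u) ≡ allRanks (length u + N) (byLastRank N F u) v
allRanks-++ N F v u = begin
  ∑< (length (v ++ u) + N) (byLastRank N F (v ++ u))
    ≡⟨ cong (λ n → ∑< n (byLastRank N F (v ++ u))) (length-+++ v u N) ⟩
  ∑< (length v + (length u + N)) (byLastRank N F (v ++ u))
    ≡⟨ ∑<-cong (length v + (length u + N)) (byLastRank-++ N F v u) ⟩
  allRanks (length u + N) (byLastRank N F u) v ∎

byLastRank-up+down : ∀ N F w r → byLastRank N F (up ∷ w) r + byLastRank N F (down ∷ w) r ≡ allRanks N F w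
byLastRank-up+down N F w r = begin
  byLastRank N F (up ∷ w) r + byLastRank N F (down ∷ w) r
    ≡⟨ ∑-distrib-+ {n} _ _ ⟨
  ∑< n (λ s → follows up s r * byLastRank N F w s + follows down s r * byLastRank N F w s)
    ≡⟨ ∑<-cong n (λ s → trans (sym (*-distribʳ-+ (byLastRank N F w s) (follows up s r) (follows down s r)))
         (trans (cong (_* byLastRank N F w s) (follows-up+down s r)) (*-identityˡ _))) ⟩
  allRanks N F w ∎
  where n = length w + N

rankings : ℕ → Word → ℕ
rankings N = allRanks N (const 1)

perms : Word → ℕ
perms = rankings 1

-- If the step after `u` is left open, the next value may take any rank, and its weight is
-- `rankings N u` whatever that rank is. This constant factors out of the count for `v`.
rankings-split : ∀ N v u → rankings N (v ++ up ∷ u) + rankings N (v ++ down ∷ u) ≡ rankings N u * rankings (suc (length u + N)) v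
rankings-split N v u = begin
  rankings N (v ++ up ∷ u) + rankings N (v ++ down ∷ u)
    ≡⟨ cong₂ _+_ (allRanks-++ N _ v (up ∷ u)) (allRanks-++ N _ v (down ∷ u)) ⟩
  allRanks M Fu v + allRanks M Fd v
    ≡⟨ ∑-distrib-+ {n} _ _ ⟨
  ∑< n (λ s → byLastRank M Fu v s + byLastRank M Fd v s)
    ≡⟨ ∑<-cong n (λ s → trans (sym (byLastRank-+ M Fu Fd v s)) (trans (byLastRank-cong M (byLastRank-up+down N _ u) v s) (byLastRank-const M _ v s))) ⟩
  ∑< n (λ s → rankings N u * byLastRank M (const 1) v s)
    ≡⟨ *-distribˡ-sum {n} (rankings N u) _ ⟨
  rankings N u * rankings M v ∎
  where
  M = suc (length u + N)
  n = length v + M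
  Fu = byLastRank N (const 1) (up ∷ u)
  Fd = byLastRank N (const 1) (down ∷ u)

-- The hockey-stick identity, shifted by a so that it can be proved by peeling off the first term.
∑<-choose : ∀ n r a k → r ≤ n →
  ∑< n (λ s → 𝟙 (s <ᵇ r) * ((s + a) C k)) + a C suc k ≡ (r + a) C suc k
∑<-choose n zero a k z≤n = cong (_+ a C suc k) (∑<-zero n)
∑<-choose (suc n) (suc r) a k (s≤s r≤n) = begin
  (a C k + 0) + ∑< n (λ s → 𝟙 (s <ᵇ r) * ((suc s + a) C k)) + a C suc k
    ≡⟨ solve 3 (λ x y z → (x :+ con 0) :+ y :+ z := y :+ (x :+ z)) refl (a C k) _ _ ⟩
  ∑< n (λ s → 𝟙 (s <ᵇ r) * ((suc s + a) C k)) + (a C k + a C suc k)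
    ≡⟨ cong₂ _+_ (∑<-cong n λ s → cong (λ t → 𝟙 (s <ᵇ r) * (t C k)) (sym (+-suc s a))) (nCk+nC[k+1]≡[n+1]C[k+1] a k) ⟩
  ∑< n (λ s → 𝟙 (s <ᵇ r) * ((s + suc a) C k)) + suc a C suc k
    ≡⟨ ∑<-choose n r (suc a) k r≤n ⟩
  (r + suc a) C suc k
    ≡⟨ cong (_C suc k) (+-suc r a) ⟩
  (suc r + a) C suc k ∎

-- The other `k` values of the increasing run are any `k` of the `r` values below the last one. The
-- bound on `r` ensures that the range of summation contains every `s < r`.
byLastRank-ups : ∀ N k r → r ≤ k + N → byLastRank (suc N) (const 1) (replicate k up) r ≡ r C k
byLastRank-ups N zero    r _   = refl
byLastRank-ups N (suc k) r r≤  = begin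
  ∑< (length (replicate k up) + suc N) (λ s → 𝟙 (s <ᵇ r) * byLastRank (suc N) (const 1) (replicate k up) s)
    ≡⟨ cong (λ n → ∑< n (λ s → 𝟙 (s <ᵇ r) * byLastRank (suc N) (const 1) (replicate k up) s))
         (trans (cong (_+ suc N) (length-replicate k)) (+-suc k N)) ⟩
  ∑< n (λ s → 𝟙 (s <ᵇ r) * byLastRank (suc N) (const 1) (replicate k up) s)
    ≡⟨ sum-cong-≗ {n} (λ i → cong (𝟙 (toℕ i <ᵇ r) *_)
         (trans (byLastRank-ups N k (toℕ i) (s≤s⁻¹ (toℕ<n i))) (cong (_C k) (sym (+-identityʳ (toℕ i)))))) ⟩
  ∑< n (λ s → 𝟙 (s <ᵇ r) * ((s + 0) C k))
    ≡⟨ +-identityʳ _ ⟨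
  ∑< n (λ s → 𝟙 (s <ᵇ r) * ((s + 0) C k)) + 0
    ≡⟨ ∑<-choose n r 0 k r≤ ⟩
  (r + 0) C suc k
    ≡⟨ cong (_C suc k) (+-identityʳ r) ⟩
  r C suc k ∎
  where n = suc k + N

𝟙<ᵇ : ∀ {n} (i : Fin n) → 𝟙 (toℕ i <ᵇ n) ≡ 1
𝟙<ᵇ Fin.zero    = refl
𝟙<ᵇ (Fin.suc i) = 𝟙<ᵇ i

-- Appending a new maximum is always an ascent, so the sum over all last ranks is the single value
-- of `byLastRank` at the top rank `n` for one more ascent.
rankings-ups : ∀ N k → rankings (suc N) (replicate k up) ≡ (k + suc N) C suc k
rankings-ups N k = begin
  rankings (suc N) (replicate k up)
    ≡⟨ cong (λ n → ∑< n (byLastRank (suc N) (const 1) (replicate k up))) (trans (cong (_+ suc N) (length-replicate k)) (+-suc k N)) ⟩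
  ∑< n (byLastRank (suc N) (const 1) (replicate k up))
    ≡⟨ sum-cong-≗ {n} (λ i → trans (sym (*-identityˡ _)) (cong (_* byLastRank (suc N) (const 1) (replicate k up) (toℕ i)) (sym (𝟙<ᵇ i)))) ⟩
  ∑< n (λ s → 𝟙 (s <ᵇ n) * byLastRank (suc N) (const 1) (replicate k up) s)
    ≡⟨ cong (λ n′ → ∑< n′ (λ s → 𝟙 (s <ᵇ n) * byLastRank (suc N) (const 1) (replicate k up) s)) (trans (cong (_+ suc N) (length-replicate k)) (+-suc k N)) ⟨
  byLastRank (suc N) (const 1) (replicate (suc k) up) n
    ≡⟨ byLastRank-ups N (suc k) n ≤-refl ⟩
  n C suc k
    ≡⟨ cong (_C suc k) (+-suc k N) ⟨
  (k + suc N) C suc k ∎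
  where n = suc k + N

-- Independence of consecutive blocks

choose-factorials : ∀ i j → ((i + j) C i) * (i ! * j !) ≡ (i + j) !
choose-factorials i j = begin
  ((i + j) C i) * (i ! * j !)
    ≡⟨ cong (λ t → ((i + j) C i) * (i ! * t !)) (m+n∸m≡n i j) ⟨
  ((i + j) C i) * (i ! * (i + j ∸ i) !)
    ≡⟨ cong (_* (i ! * (i + j ∸ i) !)) (nCk≡n!/k![n-k]! (m≤m+n i j)) ⟩
  ((i + j) ! / (i ! * (i + j ∸ i) !)) * (i ! * (i + j ∸ i) !)
    ≡⟨ m/n*n≡m (k![n∸k]!∣n! (m≤m+n i j)) ⟩
  (i + j) ! ∎
  where instance _ = i !* (i + j ∸ i) !≢0

rankings-ups-factorials : ∀ n a → rankings (suc n) (replicate a up) * (suc a ! * n !) ≡ (a + suc n) !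
rankings-ups-factorials n a = begin
  rankings (suc n) (replicate a up) * (suc a ! * n !)
    ≡⟨ cong (_* (suc a ! * n !)) (trans (rankings-ups n a) (cong (_C suc a) (+-suc a n))) ⟩
  ((suc a + n) C suc a) * (suc a ! * n !)
    ≡⟨ choose-factorials (suc a) n ⟩
  (suc a + n) !
    ≡⟨ cong _! (+-suc a n) ⟨
  (a + suc n) ! ∎

replicate-++-∷ : ∀ {A : Set} a (x : A) r → replicate a x ++ x ∷ r ≡ x ∷ replicate a x ++ r
replicate-++-∷ zero    x r = refl
replicate-++-∷ (suc a) x r = cong (x ∷_) (replicate-++-∷ a x r)

-- The factor binom(|w| + 1 + n , n) chooses the relative order of the values in w and n earlier ones.
Scales : Word → Set
Scales w = ∀ n → rankings (suc n) w * (suc (length w) ! * n !) ≡ (length w + suc n) ! * perms w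

module _ (a : ℕ) (r : Word) where
  private
    ℓ = length r
    X = suc ℓ ! * suc a !

  -- The product in `rankings-split`: the count when the step between `r` and the final run of
  -- ascents is left open.
  both : ℕ → ℕ
  both n = rankings (suc n) r * rankings (suc (ℓ + suc n)) (replicate a up)

  both-factorials : Scales r → ∀ n → both n * (X * n !) ≡ perms r * (a + suc (ℓ + suc n)) !
  both-factorials r-scales n = *-cancelʳ-≡ _ _ Y {{(ℓ + suc n) !≢0}} (begin
    both n * (X * n !) * Y
      ≡⟨ solve 6 (λ x y p q s t → (x :* y) :* ((p :* q) :* s) :* t := (x :* (p :* s)) :* (y :* (q :* t))) refl
           (rankings (suc n) r) _ (suc ℓ !) (suc a !) (n !) Y ⟩
    (rankings (suc n) r * (suc ℓ ! * n !)) * (rankings (suc (ℓ + suc n)) (replicate a up) * (suc a ! * Y))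
      ≡⟨ cong₂ _*_ (r-scales n) (rankings-ups-factorials (ℓ + suc n) a) ⟩
    (Y * perms r) * Q
      ≡⟨ solve 3 (λ y z q → (y :* z) :* q := (z :* q) :* y) refl Y (perms r) Q ⟩
    perms r * Q * Y ∎)
    where
    Y = (ℓ + suc n) !
    Q = (a + suc (ℓ + suc n)) !

  -- Comparing `both-factorials` at `n` and at 0 eliminates `perms r`; what remains is the scaling
  -- law for the sum of the two words.
  both-scales : Scales r → ∀ n → both n * ((a + suc (ℓ + 1)) ! * n !) ≡ (a + suc (ℓ + suc n)) ! * both 0
  both-scales r-scales n = *-cancelʳ-≡ _ _ X {{suc ℓ !* suc a !≢0}} (begin
    both n * (Q₀ * n !) * X
      ≡⟨ solve 4 (λ b q m x → b :* (q :* m) :* x := (b :* (x :* m)) :* q) refl (both n) Q₀ (n !) X ⟩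
    (both n * (X * n !)) * Q₀
      ≡⟨ cong (_* Q₀) (both-factorials r-scales n) ⟩
    perms r * Qₙ * Q₀
      ≡⟨ solve 3 (λ y q p → y :* q :* p := q :* (y :* p)) refl (perms r) Qₙ Q₀ ⟩
    Qₙ * (perms r * Q₀)
      ≡⟨ cong (Qₙ *_) (both-factorials r-scales 0) ⟨
    Qₙ * (both 0 * (X * 1))
      ≡⟨ solve 3 (λ q b x → q :* (b :* (x :* con 1)) := q :* b :* x) refl Qₙ (both 0) X ⟩
    Qₙ * both 0 * X ∎)
    where
    Q₀ = (a + suc (ℓ + 1)) !
    Qₙ = (a + suc (ℓ + suc n)) !

  length-ups : ∀ x → length (replicate a up ++ x ∷ r) ≡ a + suc ℓ
  length-ups x = trans (length-++ (replicate a up)) (cong (_+ suc ℓ) (length-replicate a))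

  -- The sum of the two counts scales by `both-scales`, so the law for the word with the ascent
  -- gives it, by subtraction, for the word with the descent.
  switch-down : Scales r → Scales (replicate a up ++ up ∷ r) → Scales (replicate a up ++ down ∷ r)
  switch-down r-scales up-scales n = +-cancelˡ-≡ (Qₙ * perms U) _ _ (begin
    Qₙ * perms U + rankings (suc n) D * (suc (length D) ! * n !)
      ≡⟨ cong₂ _+_ (cong (λ l → (l + suc n) ! * perms U) (trans (length-ups down) (sym (length-ups up))))
                   (cong (λ l → rankings (suc n) D * (suc l ! * n !)) (trans (length-ups down) (sym (length-ups up)))) ⟩
    (length U + suc n) ! * perms U + rankings (suc n) D * (suc (length U) ! * n !)
      ≡⟨ cong (_+ rankings (suc n) D * (suc (length U) ! * n !)) (up-scales n) ⟨
    rankings (suc n) U * (suc (length U) ! * n !) + rankings (suc n) D * (suc (length U) ! * n !)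
      ≡⟨ *-distribʳ-+ (suc (length U) ! * n !) (rankings (suc n) U) _ ⟨
    (rankings (suc n) U + rankings (suc n) D) * (suc (length U) ! * n !)
      ≡⟨ cong₂ _*_ (rankings-split (suc n) (replicate a up) r)
           (cong (λ l → l ! * n !) (trans (cong suc (length-ups up))
             (trans (sym (+-suc a (suc ℓ))) (cong (λ l → a + suc l) (sym (+-comm ℓ 1)))))) ⟩
    both n * ((a + suc (ℓ + 1)) ! * n !)
      ≡⟨ both-scales r-scales n ⟩
    (a + suc (ℓ + suc n)) ! * both 0
      ≡⟨ cong₂ _*_ (cong _! (trans (sym (+-assoc a (suc ℓ) (suc n))) (cong (_+ suc n) (sym (length-ups down)))))
           (sym (rankings-split 1 (replicate a up) r)) ⟩
    Qₙ * (perms U + perms D)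
      ≡⟨ *-distribˡ-+ Qₙ (perms U) (perms D) ⟩
    Qₙ * perms U + Qₙ * perms D ∎)
    where
    U = replicate a up ++ up ∷ r
    D = replicate a up ++ down ∷ r
    Qₙ = (length D + suc n) !

perms-ups : ∀ a → perms (replicate a up) ≡ 1
perms-ups a = *-cancelʳ-≡ _ _ (suc a !) {{suc a !≢0}} (begin
  perms (replicate a up) * suc a !        ≡⟨ cong (perms (replicate a up) *_) (*-identityʳ (suc a !)) ⟨
  perms (replicate a up) * (suc a ! * 1)  ≡⟨ rankings-ups-factorials 0 a ⟩
  (a + 1) !                           ≡⟨ cong _! (+-comm a 1) ⟩
  suc a !                             ≡⟨ *-identityˡ _ ⟨
  1 * suc a !                         ∎)

-- `a` is the length of the run of ascents that ends the permutation. Trading the descent before the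
-- run for an ascent lengthens the run, so the recursion is on `r` alone and ends at words of
-- ascents only.
ups-++-scales : ∀ a r → Scales (replicate a up ++ r)
ups-++-scales a [] rewrite ++-identityʳ (replicate a up) = λ n → begin
  rankings (suc n) (replicate a up) * (suc (length (replicate a up)) ! * n !)
    ≡⟨ cong (λ l → rankings (suc n) (replicate a up) * (suc l ! * n !)) (length-replicate a) ⟩
  rankings (suc n) (replicate a up) * (suc a ! * n !)
    ≡⟨ rankings-ups-factorials n a ⟩
  (a + suc n) !
    ≡⟨ *-identityʳ _ ⟨
  (a + suc n) ! * 1
    ≡⟨ cong₂ (λ l y → (l + suc n) ! * y) (length-replicate a) (perms-ups a) ⟨
  (length (replicate a up) + suc n) ! * perms (replicate a up) ∎
ups-++-scales a (up ∷ r)   = subst Scales (sym (replicate-++-∷ a up r)) (ups-++-scales (suc a) r)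
ups-++-scales a (down ∷ r) = switch-down a r (ups-++-scales 0 r)
  (subst Scales (sym (replicate-++-∷ a up r)) (ups-++-scales (suc a) r))

perms-split : ∀ v u → (perms (v ++ up ∷ u) + perms (v ++ down ∷ u)) * (suc (length v) ! * suc (length u) !)
                ≡ (suc (length v) + suc (length u)) ! * (perms v * perms u)
perms-split v u = begin
  (perms (v ++ up ∷ u) + perms (v ++ down ∷ u)) * (suc (length v) ! * suc (length u) !)
    ≡⟨ cong (_* (suc (length v) ! * suc (length u) !)) (rankings-split 1 v u) ⟩
  perms u * rankings (suc (length u + 1)) v * (suc (length v) ! * suc (length u) !)
    ≡⟨ cong (λ l → perms u * rankings (suc l) v * (suc (length v) ! * suc (length u) !)) (+-comm (length u) 1) ⟩
  perms u * rankings (suc (suc (length u))) v * (suc (length v) ! * suc (length u) !)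
    ≡⟨ *-assoc (perms u) _ _ ⟩
  perms u * (rankings (suc (suc (length u))) v * (suc (length v) ! * suc (length u) !))
    -- The earlier values in `Scales v` are the `suc (length u)` values of the block `u`.
    ≡⟨ cong (perms u *_) (ups-++-scales 0 v (suc (length u))) ⟩
  perms u * ((length v + suc (suc (length u))) ! * perms v)
    ≡⟨ cong (λ l → perms u * (l ! * perms v)) (+-suc (length v) (suc (length u))) ⟩
  perms u * ((suc (length v) + suc (length u)) ! * perms v)
    ≡⟨ solve 3 (λ x y z → x :* (y :* z) := y :* (z :* x)) refl (perms u) ((suc (length v) + suc (length u)) !) (perms v) ⟩
  (suc (length v) + suc (length u)) ! * (perms v * perms u) ∎

-- With the step between the blocks left open, the set of values of `v` is arbitrary; the binomial
-- coefficient chooses it.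
perms-split-choose : ∀ v u → perms (v ++ up ∷ u) + perms (v ++ down ∷ u)
                       ≡ ((suc (length v) + suc (length u)) C suc (length v)) * (perms v * perms u)
perms-split-choose v u = *-cancelʳ-≡ _ _ P {{suc (length v) !* suc (length u) !≢0}} (begin
  (perms (v ++ up ∷ u) + perms (v ++ down ∷ u)) * P           ≡⟨ perms-split v u ⟩
  (suc (length v) + suc (length u)) ! * (perms v * perms u)   ≡⟨ cong (_* (perms v * perms u)) (choose-factorials (suc (length v)) _) ⟨
  c * P * (perms v * perms u)                                 ≡⟨ solve 3 (λ x y z → x :* y :* z := x :* z :* y) refl c P (perms v * perms u) ⟩
  c * (perms v * perms u) * P                                 ∎)
  where
  P = suc (length v) ! * suc (length u) !
  c = (suc (length v) + suc (length u)) C suc (length v)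

-- Reversal of permutations

flip : Step → Step
flip up   = down
flip down = up

-- The word of the permutation read from right to left: the order of the steps is reversed and
-- ascents become descents.
rev : Word → Word
rev []      = []
rev (x ∷ w) = rev w ++ flip x ∷ []

length-rev : ∀ w → length (rev w) ≡ length w
length-rev []      = refl
length-rev (x ∷ w) = trans (length-++ (rev w)) (trans (+-comm _ 1) (cong suc (length-rev w)))

δ₀ : ℕ → ℕ
δ₀ zero    = 1
δ₀ (suc _) = 0

byLastRank-downs : ∀ k → byLastRank 1 (const 1) (replicate (suc k) down) ≗ δ₀
byLastRank-downs zero    zero    = refl
byLastRank-downs zero    (suc r) = refl
byLastRank-downs (suc k) r = begin
  ∑< (suc (length (replicate k down) + 1)) (λ s → follows down s r * byLastRank 1 (const 1) (replicate (suc k) down) s)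
    ≡⟨ ∑<-cong (suc (length (replicate k down) + 1)) (λ s → cong (follows down s r *_) (byLastRank-downs k s)) ⟩
  follows down 0 r * 1 + ∑< n (λ s → follows down (suc s) r * 0)
    ≡⟨ cong (follows down 0 r * 1 +_) (trans (∑<-cong n (λ s → *-zeroʳ (follows down (suc s) r))) (∑<-zero n)) ⟩
  follows down 0 r * 1 + 0
    ≡⟨ follows-down-0 r ⟩
  δ₀ r ∎
  where
  n = length (replicate k down) + 1
  follows-down-0 : ∀ r → follows down 0 r * 1 + 0 ≡ δ₀ r
  follows-down-0 zero    = refl
  follows-down-0 (suc r) = refl

perms-downs : ∀ a → perms (replicate a down) ≡ 1
perms-downs zero    = refl
perms-downs (suc a) = begin
  ∑< (suc n) (byLastRank 1 (const 1) (replicate (suc a) down)) ≡⟨ ∑<-cong (suc n) (byLastRank-downs a) ⟩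
  1 + ∑< n (const 0)                                    ≡⟨ cong suc (∑<-zero n) ⟩
  1                                                     ∎
  where n = length (replicate a down) + 1

-- By perms-split, turning a descent into an ascent costs only terms for shorter words, so that the
-- claim reduces to words without descents. The same idea proves ups-++-scales.
perms-rev-++ : ∀ a r → perms (rev r ++ replicate a down) ≡ perms (replicate a up ++ r)
perms-rev-++ a [] = begin
  perms (replicate a down)      ≡⟨ perms-downs a ⟩
  1                         ≡⟨ perms-ups a ⟨
  perms (replicate a up)        ≡⟨ cong perms (++-identityʳ (replicate a up)) ⟨
  perms (replicate a up ++ [])  ∎
perms-rev-++ a (up ∷ r) = begin
  perms ((rev r ++ down ∷ []) ++ replicate a down) ≡⟨ cong perms (++-assoc (rev r) (down ∷ []) _) ⟩
  perms (rev r ++ replicate (suc a) down)          ≡⟨ perms-rev-++ (suc a) r ⟩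
  perms (up ∷ replicate a up ++ r)                 ≡⟨ cong perms (replicate-++-∷ a up r) ⟨
  perms (replicate a up ++ up ∷ r)                 ∎
perms-rev-++ a (down ∷ r) = begin
  perms ((rev r ++ up ∷ []) ++ replicate a down) ≡⟨ cong perms (++-assoc (rev r) (up ∷ []) _) ⟩
  perms (rev r ++ up ∷ replicate a down)         ≡⟨ +-cancelʳ-≡ (perms (replicate a up ++ up ∷ r)) _ _ (begin
    perms (rev r ++ up ∷ replicate a down) + perms (replicate a up ++ up ∷ r)
      ≡⟨ cong (perms (rev r ++ up ∷ replicate a down) +_) (trans (cong perms (replicate-++-∷ a up r)) (sym (perms-rev-++ (suc a) r))) ⟩
    perms (rev r ++ up ∷ replicate a down) + perms (rev r ++ down ∷ replicate a down)
      ≡⟨ *-cancelʳ-≡ _ _ (suc ℓ ! * suc a !) {{suc ℓ !* suc a !≢0}} mirrored ⟩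
    perms (replicate a up ++ up ∷ r) + perms (replicate a up ++ down ∷ r)
      ≡⟨ +-comm (perms (replicate a up ++ up ∷ r)) _ ⟩
    perms (replicate a up ++ down ∷ r) + perms (replicate a up ++ up ∷ r) ∎) ⟩
  perms (replicate a up ++ down ∷ r)             ∎
  where
  ℓ = length r
  split : ∀ v u i j → length v ≡ i → length u ≡ j →
    (perms (v ++ up ∷ u) + perms (v ++ down ∷ u)) * (suc i ! * suc j !) ≡ (suc i + suc j) ! * (perms v * perms u)
  split v u _ _ refl refl = perms-split v u
  mirrored : (perms (rev r ++ up ∷ replicate a down) + perms (rev r ++ down ∷ replicate a down)) * (suc ℓ ! * suc a !)
           ≡ (perms (replicate a up ++ up ∷ r) + perms (replicate a up ++ down ∷ r)) * (suc ℓ ! * suc a !)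
  -- By `perms-split` both sums depend only on the two blocks, which are `r` and the run, up to
  -- reversal. The run has count 1 in either direction, and `r` by itself is the claim for `a = 0`.
  mirrored = begin
    (perms (rev r ++ up ∷ replicate a down) + perms (rev r ++ down ∷ replicate a down)) * (suc ℓ ! * suc a !)
      ≡⟨ split (rev r) (replicate a down) ℓ a (length-rev r) (length-replicate a) ⟩
    (suc ℓ + suc a) ! * (perms (rev r) * perms (replicate a down))
      ≡⟨ cong₂ (λ x y → (suc ℓ + suc a) ! * (x * y)) (trans (cong perms (sym (++-identityʳ (rev r)))) (perms-rev-++ 0 r)) (trans (perms-downs a) (sym (perms-ups a))) ⟩
    (suc ℓ + suc a) ! * (perms r * perms (replicate a up))
      ≡⟨ cong₂ (λ x y → x ! * y) (+-comm (suc ℓ) (suc a)) (*-comm (perms r) _) ⟩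
    (suc a + suc ℓ) ! * (perms (replicate a up) * perms r)
      ≡⟨ split (replicate a up) r a ℓ (length-replicate a) refl ⟨
    (perms (replicate a up ++ up ∷ r) + perms (replicate a up ++ down ∷ r)) * (suc a ! * suc ℓ !)
      ≡⟨ cong ((perms (replicate a up ++ up ∷ r) + perms (replicate a up ++ down ∷ r)) *_) (*-comm (suc a !) _) ⟩
    (perms (replicate a up ++ up ∷ r) + perms (replicate a up ++ down ∷ r)) * (suc ℓ ! * suc a !) ∎

perms-rev : ∀ w → perms (rev w) ≡ perms w
perms-rev w = trans (cong perms (sym (++-identityʳ (rev w)))) (perms-rev-++ 0 w)

-- Sums over all words of a given length

∑Word : ℕ → (Word → ℕ) → ℕ
∑Word zero    φ = φ []
∑Word (suc m) φ = ∑Word m (φ ∘ (up ∷_)) + ∑Word m (φ ∘ (down ∷_))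

∑Word-cong : ∀ m {φ ψ : Word → ℕ} → (∀ w → length w ≡ m → φ w ≡ ψ w) → ∑Word m φ ≡ ∑Word m ψ
∑Word-cong zero    φ≡ψ = φ≡ψ [] refl
∑Word-cong (suc m) φ≡ψ = cong₂ _+_ (∑Word-cong m λ w |w| → φ≡ψ (up ∷ w) (cong suc |w|))
                                (∑Word-cong m λ w |w| → φ≡ψ (down ∷ w) (cong suc |w|))

+-interchange : ∀ a b c d → (a + b) + (c + d) ≡ (a + c) + (b + d)
+-interchange = solve 4 (λ a b c d → (a :+ b) :+ (c :+ d) := (a :+ c) :+ (b :+ d)) refl

∑Word-+ : ∀ m (φ ψ : Word → ℕ) → ∑Word m (λ w → φ w + ψ w) ≡ ∑Word m φ + ∑Word m ψ
∑Word-+ zero    φ ψ = refl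
∑Word-+ (suc m) φ ψ = trans (cong₂ _+_ (∑Word-+ m _ _) (∑Word-+ m _ _))
  (+-interchange (∑Word m (φ ∘ (up ∷_))) _ _ _)

∑Word-*ˡ : ∀ m a (φ : Word → ℕ) → ∑Word m (λ w → a * φ w) ≡ a * ∑Word m φ
∑Word-*ˡ zero    a φ = refl
∑Word-*ˡ (suc m) a φ = trans (cong₂ _+_ (∑Word-*ˡ m a _) (∑Word-*ˡ m a _)) (sym (*-distribˡ-+ a _ _))

∑Word-*ʳ : ∀ m a (φ : Word → ℕ) → ∑Word m (λ w → φ w * a) ≡ ∑Word m φ * a
∑Word-*ʳ m a φ = trans (∑Word-cong m λ w _ → *-comm (φ w) a) (trans (∑Word-*ˡ m a φ) (*-comm a _))

∑Word-snoc : ∀ m (φ : Word → ℕ) →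
  ∑Word (suc m) φ ≡ ∑Word m (λ w → φ (w ++ up ∷ [])) + ∑Word m (λ w → φ (w ++ down ∷ []))
∑Word-snoc zero    φ = refl
∑Word-snoc (suc m) φ = trans (cong₂ _+_ (∑Word-snoc m (φ ∘ (up ∷_))) (∑Word-snoc m (φ ∘ (down ∷_))))
  (+-interchange (∑Word m (λ w → φ (up ∷ w ++ up ∷ []))) _ _ _)

∑Word-rev : ∀ m (φ : Word → ℕ) → ∑Word m (φ ∘ rev) ≡ ∑Word m φ
∑Word-rev zero    φ = refl
∑Word-rev (suc m) φ = begin
  ∑Word m (λ w → φ (rev w ++ down ∷ [])) + ∑Word m (λ w → φ (rev w ++ up ∷ []))
    ≡⟨ cong₂ _+_ (∑Word-rev m (λ w → φ (w ++ down ∷ []))) (∑Word-rev m (λ w → φ (w ++ up ∷ []))) ⟩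
  ∑Word m (λ w → φ (w ++ down ∷ [])) + ∑Word m (λ w → φ (w ++ up ∷ []))
    ≡⟨ +-comm (∑Word m (λ w → φ (w ++ down ∷ []))) _ ⟩
  ∑Word m (λ w → φ (w ++ up ∷ [])) + ∑Word m (λ w → φ (w ++ down ∷ []))
    ≡⟨ ∑Word-snoc m φ ⟨
  ∑Word (suc m) φ ∎

perms-up+down : ∀ w → perms (up ∷ w) + perms (down ∷ w) ≡ suc (suc (length w)) * perms w
perms-up+down w = begin
  perms (up ∷ w) + perms (down ∷ w)          ≡⟨ rankings-split 1 [] w ⟩
  perms w * rankings (suc (length w + 1)) []    ≡⟨ cong (perms w *_) (∑<-one (suc (length w + 1))) ⟩
  perms w * suc (length w + 1)           ≡⟨ cong (λ l → perms w * suc l) (+-comm (length w) 1) ⟩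
  perms w * suc (suc (length w))         ≡⟨ *-comm (perms w) _ ⟩
  suc (suc (length w)) * perms w         ∎

∑Word-perms : ∀ m → ∑Word m perms ≡ suc m !
∑Word-perms zero    = refl
∑Word-perms (suc m) = begin
  ∑Word m (perms ∘ (up ∷_)) + ∑Word m (perms ∘ (down ∷_))  ≡⟨ ∑Word-+ m _ _ ⟨
  ∑Word m (λ w → perms (up ∷ w) + perms (down ∷ w))     ≡⟨ ∑Word-cong m (λ { w refl → perms-up+down w }) ⟩
  ∑Word m (λ w → suc (suc m) * perms w)             ≡⟨ ∑Word-*ˡ m (suc (suc m)) perms ⟩
  suc (suc m) * ∑Word m perms                       ≡⟨ cong (suc (suc m) *_) (∑Word-perms m) ⟩
  suc (suc m) !                              ∎

-- Positive words and their reversals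

-- The least surplus of descents over ascents before w for which the surplus stays nonnegative
-- throughout w and is at least d after w.
deficit : ℕ → Word → ℕ
deficit d []         = d
deficit d (up ∷ w)   = deficit (suc d) w
deficit d (down ∷ w) = deficit (pred d) w

isZero : ℕ → Bool
isZero zero    = true
isZero (suc _) = false

-- Starting from surplus 0, the word is positive and ends with surplus at least `d`. The parameter
-- is needed because words are consumed from their last step; `roomy 0` is positivity.
roomy : ℕ → Word → Bool
roomy d w = isZero (deficit d w)

-- With ascents counted as +1 and descents as −1, no height exceeds the final one by more than h.
peaksAtEnd : ℕ → Word → Bool
peaksAtEnd h       []         = true
peaksAtEnd h       (up ∷ w)   = peaksAtEnd (suc h) w
peaksAtEnd zero    (down ∷ w) = false
peaksAtEnd (suc h) (down ∷ w) = peaksAtEnd h w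

deficit-++ : ∀ d v u → deficit d (v ++ u) ≡ deficit (deficit d v) u
deficit-++ d []         u = refl
deficit-++ d (up ∷ v)   u = deficit-++ (suc d) v u
deficit-++ d (down ∷ v) u = deficit-++ (pred d) v u

-- The reversed path starts at the former final point, and its deficit is the greatest height that
-- it reaches above this start.
peaksAtEnd-deficit-rev : ∀ h w → peaksAtEnd h w ≡ (deficit 0 (rev w) ≤ᵇ h)
peaksAtEnd-deficit-rev h [] = refl
peaksAtEnd-deficit-rev h (up ∷ w) = begin
  peaksAtEnd (suc h) w                                   ≡⟨ peaksAtEnd-deficit-rev (suc h) w ⟩
  (deficit 0 (rev w) ≤ᵇ suc h)                    ≡⟨ pred-≤ᵇ (deficit 0 (rev w)) ⟩
  (pred (deficit 0 (rev w)) ≤ᵇ h)                 ≡⟨ cong (_≤ᵇ h) (deficit-++ 0 (rev w) (down ∷ [])) ⟨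
  (deficit 0 (rev w ++ down ∷ []) ≤ᵇ h)           ∎
  where
  pred-≤ᵇ : ∀ e → (e ≤ᵇ suc h) ≡ (pred e ≤ᵇ h)
  pred-≤ᵇ zero          = refl
  pred-≤ᵇ (suc zero)    = refl
  pred-≤ᵇ (suc (suc e)) = refl
peaksAtEnd-deficit-rev zero    (down ∷ w) = cong (_≤ᵇ 0) (sym (deficit-++ 0 (rev w) (up ∷ [])))
peaksAtEnd-deficit-rev (suc h) (down ∷ w) = begin
  peaksAtEnd h w                                   ≡⟨ peaksAtEnd-deficit-rev h w ⟩
  (deficit 0 (rev w) ≤ᵇ h)                  ≡⟨ suc-≤ᵇ (deficit 0 (rev w)) ⟩
  (suc (deficit 0 (rev w)) ≤ᵇ suc h)        ≡⟨ cong (_≤ᵇ suc h) (deficit-++ 0 (rev w) (up ∷ [])) ⟨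
  (deficit 0 (rev w ++ up ∷ []) ≤ᵇ suc h)   ∎
  where
  suc-≤ᵇ : ∀ e → (e ≤ᵇ h) ≡ (suc e ≤ᵇ suc h)
  suc-≤ᵇ zero    = refl
  suc-≤ᵇ (suc e) = refl

peaksAtEnd-rev : ∀ w → peaksAtEnd 0 w ≡ roomy 0 (rev w)
peaksAtEnd-rev w = trans (peaksAtEnd-deficit-rev 0 w) (≤ᵇ-0 (deficit 0 (rev w)))
  where
  ≤ᵇ-0 : ∀ e → (e ≤ᵇ 0) ≡ isZero e
  ≤ᵇ-0 zero    = refl
  ≤ᵇ-0 (suc e) = refl

-- A word of length `m` belongs to permutations of `suc m` values, so this is the number
-- `b (m + 1)`.
#positive : ℕ → ℕ
#positive m = ∑Word m (λ w → perms w * 𝟙 (roomy 0 w))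

#positive-peaksAtEnd : ∀ m → ∑Word m (λ w → perms w * 𝟙 (peaksAtEnd 0 w)) ≡ #positive m
#positive-peaksAtEnd m = begin
  ∑Word m (λ w → perms w * 𝟙 (peaksAtEnd 0 w))
    ≡⟨ ∑Word-cong m (λ w _ → cong₂ (λ x y → x * 𝟙 y) (sym (perms-rev w)) (peaksAtEnd-rev w)) ⟩
  ∑Word m (λ w → perms (rev w) * 𝟙 (roomy 0 (rev w)))
    ≡⟨ ∑Word-rev m (λ w → perms w * 𝟙 (roomy 0 w)) ⟩
  #positive m ∎

-- Cutting paths at a maximum

at : Step → Step → ℕ → ℕ
at up   up   n = n
at up   down n = 0
at down up   n = 0
at down down n = n

-- Sums φ v u over all the factorizations w = v ++ x ∷ u.
splits : Step → (Word → Word → ℕ) → Word → ℕ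
splits x φ []      = 0
splits x φ (y ∷ w) = at x y (φ [] w) + splits x (φ ∘ (y ∷_)) w

splits-*ˡ : ∀ x (F : Word → ℕ) ψ w → F w * splits x ψ w ≡ splits x (λ v u → F (v ++ x ∷ u) * ψ v u) w
splits-*ˡ x F ψ []      = *-zeroʳ (F [])
splits-*ˡ x F ψ (y ∷ w) = trans (*-distribˡ-+ (F (y ∷ w)) (at x y (ψ [] w)) _)
  (cong₂ _+_ (at-*ˡ x y) (splits-*ˡ x (F ∘ (y ∷_)) (ψ ∘ (y ∷_)) w))
  where
  at-*ˡ : ∀ x y → F (y ∷ w) * at x y (ψ [] w) ≡ at x y (F (x ∷ w) * ψ [] w)
  at-*ˡ up   up   = refl
  at-*ˡ up   down = *-zeroʳ (F (down ∷ w))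
  at-*ˡ down up   = *-zeroʳ (F (up ∷ w))
  at-*ˡ down down = refl

∑anti : ℕ → (ℕ → ℕ → ℕ) → ℕ
∑anti zero    h = h 0 0
∑anti (suc n) h = h 0 (suc n) + ∑anti n (h ∘ suc)

∑anti-cong : ∀ n {h k : ℕ → ℕ → ℕ} → (∀ i j → i + j ≡ n → h i j ≡ k i j) → ∑anti n h ≡ ∑anti n k
∑anti-cong zero    h≡k = h≡k 0 0 refl
∑anti-cong (suc n) h≡k = cong₂ _+_ (h≡k 0 (suc n) refl) (∑anti-cong n λ i j i+j → h≡k (suc i) j (cong suc i+j))

∑anti-+ : ∀ n (h k : ℕ → ℕ → ℕ) → ∑anti n (λ i j → h i j + k i j) ≡ ∑anti n h + ∑anti n k
∑anti-+ zero    h k = refl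
∑anti-+ (suc n) h k = trans (cong (h 0 (suc n) + k 0 (suc n) +_) (∑anti-+ n (h ∘ suc) (k ∘ suc)))
  (+-interchange (h 0 (suc n)) _ _ _)

∑Word-splits : ∀ m x φ → ∑Word (suc m) (splits x φ) ≡ ∑anti m (λ i j → ∑Word i λ v → ∑Word j λ u → φ v u)
∑Word-splits zero up   φ = trans (+-identityʳ _) (+-identityʳ _)
∑Word-splits zero down φ = +-identityʳ _
∑Word-splits (suc m) x φ = begin
  ∑Word (suc m) (λ w → at x up (φ [] w) + splits x (φ ∘ (up ∷_)) w)
    + ∑Word (suc m) (λ w → at x down (φ [] w) + splits x (φ ∘ (down ∷_)) w)
    ≡⟨ cong₂ _+_ (∑Word-+ (suc m) (at x up ∘ φ []) (splits x (φ ∘ (up ∷_))))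
                 (∑Word-+ (suc m) (at x down ∘ φ []) (splits x (φ ∘ (down ∷_)))) ⟩
  (∑Word (suc m) (λ w → at x up (φ [] w)) + ∑Word (suc m) (splits x (φ ∘ (up ∷_))))
    + (∑Word (suc m) (λ w → at x down (φ [] w)) + ∑Word (suc m) (splits x (φ ∘ (down ∷_))))
    ≡⟨ +-interchange (∑Word (suc m) (λ w → at x up (φ [] w))) _ _ _ ⟩
  (∑Word (suc m) (λ w → at x up (φ [] w)) + ∑Word (suc m) (λ w → at x down (φ [] w)))
    + (∑Word (suc m) (splits x (φ ∘ (up ∷_))) + ∑Word (suc m) (splits x (φ ∘ (down ∷_))))
    ≡⟨ cong₂ _+_ (trans (sym (∑Word-+ (suc m) (at x up ∘ φ []) (at x down ∘ φ []))) (∑Word-cong (suc m) λ w _ → at-up+down x (φ [] w)))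
         (trans (cong₂ _+_ (∑Word-splits m x (φ ∘ (up ∷_))) (∑Word-splits m x (φ ∘ (down ∷_)))) (sym (∑anti-+ m _ _))) ⟩
  ∑anti (suc m) (λ i j → ∑Word i λ v → ∑Word j λ u → φ v u) ∎
  where
  at-up+down : ∀ x n → at x up n + at x down n ≡ n
  at-up+down up   n = +-identityʳ n
  at-up+down down n = refl

-- For d = 0 this marks the factorizations at a maximum of the height: the earlier part u ends at
-- its maximum and the later part v starts at its maximum.
record-split : ℕ → Word → Word → ℕ
record-split d v u = 𝟙 (roomy d v) * 𝟙 (peaksAtEnd 0 u)

-- For d = 0: unless the last maximum is the final point, exactly one factorization cuts right after it.
-- In splits-up-0 the cut is right before the first maximum.
splits-down : ∀ d w → splits down (record-split d) w + 𝟙 (peaksAtEnd d w) ≡ 1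
splits-down d       []         = refl
splits-down d       (up ∷ w)   = splits-down (suc d) w
splits-down zero    (down ∷ w) = begin
  (𝟙 (peaksAtEnd 0 w) + 0) + splits down (record-split 0) w + 0
    ≡⟨ solve 2 (λ x y → (x :+ con 0) :+ y :+ con 0 := y :+ x) refl (𝟙 (peaksAtEnd 0 w)) _ ⟩
  splits down (record-split 0) w + 𝟙 (peaksAtEnd 0 w)
    ≡⟨ splits-down 0 w ⟩
  1 ∎
splits-down (suc d) (down ∷ w) = splits-down d w

mutual
  splits-up-0 : ∀ w → splits up (record-split 0) w + 𝟙 (roomy 0 w) ≡ 1
  splits-up-0 []         = refl
  splits-up-0 (down ∷ w) = splits-up-0 w
  splits-up-0 (up ∷ w)   = begin
    (𝟙 (peaksAtEnd 0 w) + 0) + splits up (record-split 1) w + 𝟙 (roomy 1 w)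
      ≡⟨ solve 3 (λ x y z → (x :+ con 0) :+ y :+ z := y :+ z :+ x) refl (𝟙 (peaksAtEnd 0 w)) _ _ ⟩
    splits up (record-split 1) w + 𝟙 (roomy 1 w) + 𝟙 (peaksAtEnd 0 w)
      ≡⟨ splits-up-suc 0 w ⟩
    1 ∎

  -- Here `suc d` is how far the later steps, already read, climb above the end of `w`. Either the
  -- first maximum is reached by an ascent within `w`, or it is the start (`roomy`), or it comes
  -- after `w` and is strictly higher than everything in `w` (`peaksAtEnd d`).
  splits-up-suc : ∀ d w → splits up (record-split (suc d)) w + 𝟙 (roomy (suc d) w) + 𝟙 (peaksAtEnd d w) ≡ 1
  splits-up-suc d       []         = refl
  splits-up-suc d       (up ∷ w)   = splits-up-suc (suc d) w
  splits-up-suc zero    (down ∷ w) = trans (+-identityʳ _) (splits-up-0 w)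
  splits-up-suc (suc d) (down ∷ w) = splits-up-suc d w

split-sum : Step → ℕ → ℕ
split-sum x m = ∑Word m (λ w → perms w * splits x (record-split 0) w)

∑Word-perms-partition : ∀ m (φ ψ : Word → ℕ) → (∀ w → φ w + ψ w ≡ 1) →
  ∑Word m (λ w → perms w * φ w) + ∑Word m (λ w → perms w * ψ w) ≡ suc m !
∑Word-perms-partition m φ ψ φ+ψ≡1 = begin
  ∑Word m (λ w → perms w * φ w) + ∑Word m (λ w → perms w * ψ w)
    ≡⟨ ∑Word-+ m _ _ ⟨
  ∑Word m (λ w → perms w * φ w + perms w * ψ w)
    ≡⟨ ∑Word-cong m (λ w _ → trans (sym (*-distribˡ-+ (perms w) (φ w) (ψ w))) (trans (cong (perms w *_) (φ+ψ≡1 w)) (*-identityʳ (perms w)))) ⟩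
  ∑Word m perms
    ≡⟨ ∑Word-perms m ⟩
  suc m ! ∎

-- Both gluing steps are summed together so that `perms-split-choose` applies; the condition
-- `record-split` does not see the step and factors over the two blocks.
split-sums : ∀ m → split-sum up (suc m) + split-sum down (suc m)
  ≡ ∑anti m (λ i j → ((suc i + suc j) C suc i) * (#positive i * #positive j))
split-sums m = begin
  split-sum up (suc m) + split-sum down (suc m)
    ≡⟨ cong₂ _+_ (expand up) (expand down) ⟩
  ∑anti m (sums up) + ∑anti m (sums down)
    ≡⟨ ∑anti-+ m _ _ ⟨
  ∑anti m (λ i j → sums up i j + sums down i j)
    ≡⟨ ∑anti-cong m (λ i j _ → merge i j) ⟩
  ∑anti m (λ i j → ((suc i + suc j) C suc i) * (#positive i * #positive j)) ∎
  where
  term : Step → Word → Word → ℕ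
  term x v u = perms (v ++ x ∷ u) * record-split 0 v u
  sums : Step → ℕ → ℕ → ℕ
  sums x i j = ∑Word i λ v → ∑Word j λ u → term x v u
  expand : ∀ x → split-sum x (suc m) ≡ ∑anti m (sums x)
  expand x = trans (∑Word-cong (suc m) λ w _ → splits-*ˡ x perms (record-split 0) w) (∑Word-splits m x (term x))
  merge : ∀ i j → sums up i j + sums down i j ≡ ((suc i + suc j) C suc i) * (#positive i * #positive j)
  merge i j = begin
    sums up i j + sums down i j
      ≡⟨ ∑Word-+ i _ _ ⟨
    ∑Word i (λ v → ∑Word j (term up v) + ∑Word j (term down v))
      ≡⟨ ∑Word-cong i (λ v |v| → trans (sym (∑Word-+ j _ _)) (∑Word-cong j λ u |u| → combine v u |v| |u|)) ⟩
    ∑Word i (λ v → ∑Word j λ u → c * (perms v * 𝟙 (roomy 0 v)) * (perms u * 𝟙 (peaksAtEnd 0 u)))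
      ≡⟨ ∑Word-cong i (λ v _ → ∑Word-*ˡ j (c * (perms v * 𝟙 (roomy 0 v))) _) ⟩
    ∑Word i (λ v → c * (perms v * 𝟙 (roomy 0 v)) * ∑Word j (λ u → perms u * 𝟙 (peaksAtEnd 0 u)))
      ≡⟨ ∑Word-*ʳ i _ _ ⟩
    ∑Word i (λ v → c * (perms v * 𝟙 (roomy 0 v))) * ∑Word j (λ u → perms u * 𝟙 (peaksAtEnd 0 u))
      ≡⟨ cong₂ _*_ (∑Word-*ˡ i c _) (#positive-peaksAtEnd j) ⟩
    c * #positive i * #positive j
      ≡⟨ *-assoc c (#positive i) (#positive j) ⟩
    c * (#positive i * #positive j) ∎
    where
    c = (suc i + suc j) C suc i
    combine : ∀ v u → length v ≡ i → length u ≡ j →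
      term up v u + term down v u ≡ c * (perms v * 𝟙 (roomy 0 v)) * (perms u * 𝟙 (peaksAtEnd 0 u))
    combine v u refl refl = begin
      term up v u + term down v u
        ≡⟨ *-distribʳ-+ (record-split 0 v u) (perms (v ++ up ∷ u)) _ ⟨
      (perms (v ++ up ∷ u) + perms (v ++ down ∷ u)) * record-split 0 v u
        ≡⟨ cong (_* record-split 0 v u) (perms-split-choose v u) ⟩
      c * (perms v * perms u) * (𝟙 (roomy 0 v) * 𝟙 (peaksAtEnd 0 u))
        ≡⟨ solve 5 (λ c x y a b → c :* (x :* y) :* (a :* b) := c :* (x :* a) :* (y :* b)) refl
             c (perms v) (perms u) (𝟙 (roomy 0 v)) (𝟙 (peaksAtEnd 0 u)) ⟩
      c * (perms v * 𝟙 (roomy 0 v)) * (perms u * 𝟙 (peaksAtEnd 0 u)) ∎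

-- Each kind of cut accounts for every permutation once, except those with the start as a maximum
-- (cut at an ascent) or the end as a maximum (cut at a descent). Either exceptional family has
-- `#positive (suc m)` members.
#positive-recurrence : ∀ m →
  ∑anti m (λ i j → ((suc i + suc j) C suc i) * (#positive i * #positive j)) + 2 * #positive (suc m) ≡ 2 * suc (suc m) !
#positive-recurrence m = begin
  ∑anti m (λ i j → ((suc i + suc j) C suc i) * (#positive i * #positive j)) + 2 * #positive (suc m)
    ≡⟨ cong (_+ 2 * #positive (suc m)) (split-sums m) ⟨
  split-sum up (suc m) + split-sum down (suc m) + 2 * #positive (suc m)
    ≡⟨ solve 3 (λ x y b → x :+ y :+ con 2 :* b := (x :+ b) :+ (y :+ b)) refl (split-sum up (suc m)) _ (#positive (suc m)) ⟩
  (split-sum up (suc m) + #positive (suc m)) + (split-sum down (suc m) + #positive (suc m))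
    ≡⟨ cong₂ _+_ (∑Word-perms-partition (suc m) (splits up (record-split 0)) (𝟙 ∘ roomy 0) splits-up-0)
         (trans (cong (split-sum down (suc m) +_) (sym (#positive-peaksAtEnd (suc m)))) (∑Word-perms-partition (suc m) (splits down (record-split 0)) (𝟙 ∘ peaksAtEnd 0) (splits-down 0))) ⟩
  suc (suc m) ! + suc (suc m) !
    ≡⟨ cong (suc (suc m) ! +_) (+-identityʳ _) ⟨
  2 * suc (suc m) ! ∎

-- Dyck words

-- Positivity can fail only at the very end, so the last step is an ascent from a surplus of exactly
-- 0: `roomy 0` but not `roomy 1`.
dyck : Word → Bool
dyck []         = false
dyck (up ∷ w)   = roomy 0 w ∧ not (roomy 1 w)
dyck (down ∷ w) = false

#dyck : ℕ → ℕ
#dyck m = ∑Word m (λ w → perms w * 𝟙 (dyck w))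

roomy-weaken : ∀ d w → roomy (suc d) w ≡ true → roomy d w ≡ true
roomy-weaken d       (up ∷ w)   = roomy-weaken (suc d) w
roomy-weaken zero    (down ∷ w) = λ r → r
roomy-weaken (suc d) (down ∷ w) = roomy-weaken d w

-- `roomy 1 w` is by definition `roomy 0 (up ∷ w)`: a positive word followed by an ascent either
-- stays positive or becomes Dyck.
roomy-or-dyck : ∀ w → 𝟙 (roomy 1 w) + 𝟙 (dyck (up ∷ w)) ≡ 𝟙 (roomy 0 w)
roomy-or-dyck w with roomy 1 w in eq
... | true  rewrite roomy-weaken 0 w eq = refl
... | false with roomy 0 w
...   | true  = refl
...   | false = refl

#positive+#dyck : ∀ m → #positive (suc m) + #dyck (suc m) ≡ suc (suc m) * #positive m
#positive+#dyck m = begin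
  #positive (suc m) + #dyck (suc m)
    ≡⟨ ∑Word-+ (suc m) (λ w → perms w * 𝟙 (roomy 0 w)) (λ w → perms w * 𝟙 (dyck w)) ⟨
  ∑Word (suc m) (λ w → perms w * 𝟙 (roomy 0 w) + perms w * 𝟙 (dyck w))
    ≡⟨ ∑Word-+ m _ _ ⟨
  ∑Word m (λ w → (perms (up ∷ w) * 𝟙 (roomy 1 w) + perms (up ∷ w) * 𝟙 (dyck (up ∷ w))) + (perms (down ∷ w) * 𝟙 (roomy 0 w) + perms (down ∷ w) * 0))
    ≡⟨ ∑Word-cong m (λ { w refl → extend w }) ⟩
  ∑Word m (λ w → suc (suc m) * (perms w * 𝟙 (roomy 0 w)))
    ≡⟨ ∑Word-*ˡ m (suc (suc m)) _ ⟩
  suc (suc m) * #positive m ∎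
  where
  extend : ∀ w → (perms (up ∷ w) * 𝟙 (roomy 1 w) + perms (up ∷ w) * 𝟙 (dyck (up ∷ w))) + (perms (down ∷ w) * 𝟙 (roomy 0 w) + perms (down ∷ w) * 0)
    ≡ suc (suc (length w)) * (perms w * 𝟙 (roomy 0 w))
  extend w = begin
    (perms (up ∷ w) * 𝟙 (roomy 1 w) + perms (up ∷ w) * 𝟙 (dyck (up ∷ w))) + (perms (down ∷ w) * 𝟙 (roomy 0 w) + perms (down ∷ w) * 0)
      ≡⟨ solve 5 (λ x y a b c → (x :* a :+ x :* b) :+ (y :* c :+ y :* con 0) := x :* (a :+ b) :+ y :* c) refl
           (perms (up ∷ w)) (perms (down ∷ w)) (𝟙 (roomy 1 w)) (𝟙 (dyck (up ∷ w))) (𝟙 (roomy 0 w)) ⟩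
    perms (up ∷ w) * (𝟙 (roomy 1 w) + 𝟙 (dyck (up ∷ w))) + perms (down ∷ w) * 𝟙 (roomy 0 w)
      ≡⟨ cong (λ t → perms (up ∷ w) * t + perms (down ∷ w) * 𝟙 (roomy 0 w)) (roomy-or-dyck w) ⟩
    perms (up ∷ w) * 𝟙 (roomy 0 w) + perms (down ∷ w) * 𝟙 (roomy 0 w)
      ≡⟨ *-distribʳ-+ (𝟙 (roomy 0 w)) (perms (up ∷ w)) _ ⟨
    (perms (up ∷ w) + perms (down ∷ w)) * 𝟙 (roomy 0 w)
      ≡⟨ cong (_* 𝟙 (roomy 0 w)) (perms-up+down w) ⟩
    suc (suc (length w)) * perms w * 𝟙 (roomy 0 w)
      ≡⟨ *-assoc (suc (suc (length w))) (perms w) _ ⟩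
    suc (suc (length w)) * (perms w * 𝟙 (roomy 0 w)) ∎

-- Solving the recurrence with exponential generating functions

∑anti-snoc : ∀ n (h : ℕ → ℕ → ℕ) → ∑anti (suc n) h ≡ ∑anti n (λ i j → h i (suc j)) + h (suc n) 0
∑anti-snoc zero    h = refl
∑anti-snoc (suc n) h = trans (cong (h 0 (suc (suc n)) +_) (∑anti-snoc n (h ∘ suc))) (sym (+-assoc (h 0 (suc (suc n))) _ _))

-- The binomial convolution Σ binom(n , i) h i (n − i), defined through the Leibniz rule.
binConv : ℕ → (ℕ → ℕ → ℕ) → ℕ
binConv zero    h = h 0 0
binConv (suc n) h = binConv n (h ∘ suc) + binConv n (λ i j → h i (suc j))

binConv-cong : ∀ n {h k : ℕ → ℕ → ℕ} → (∀ i j → h i j ≡ k i j) → binConv n h ≡ binConv n k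
binConv-cong zero    h≡k = h≡k 0 0
binConv-cong (suc n) h≡k = cong₂ _+_ (binConv-cong n λ i j → h≡k (suc i) j) (binConv-cong n λ i j → h≡k i (suc j))

binConv-+ : ∀ n (h k : ℕ → ℕ → ℕ) → binConv n (λ i j → h i j + k i j) ≡ binConv n h + binConv n k
binConv-+ zero    h k = refl
binConv-+ (suc n) h k = trans (cong₂ _+_ (binConv-+ n _ _) (binConv-+ n _ _)) (+-interchange (binConv n (h ∘ suc)) _ _ _)

binConv-swap : ∀ n (h : ℕ → ℕ → ℕ) → binConv n (λ i j → h j i) ≡ binConv n h
binConv-swap zero    h = refl
binConv-swap (suc n) h = trans (cong₂ _+_ (binConv-swap n (λ i j → h i (suc j))) (binConv-swap n (h ∘ suc)))
  (+-comm (binConv n (λ i j → h i (suc j))) _)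

-- The absorption identity `i binom(n + 1 , i) = (n + 1) binom(n , i − 1)`, proved from the Leibniz
-- rule.
binConv-absorb : ∀ n (h : ℕ → ℕ → ℕ) → binConv (suc n) (λ i j → i * h i j) ≡ suc n * binConv n (h ∘ suc)
binConv-absorb zero    h = +-identityʳ _
binConv-absorb (suc n) h = begin
  binConv (suc n) (λ i j → suc i * h (suc i) j) + binConv (suc n) (λ i j → i * h i (suc j))
    ≡⟨ cong₂ _+_ (binConv-+ (suc n) (h ∘ suc) (λ i j → i * h (suc i) j)) (binConv-absorb n (λ i j → h i (suc j))) ⟩
  binConv (suc n) (h ∘ suc) + binConv (suc n) (λ i j → i * h (suc i) j) + suc n * binConv n (λ i j → h (suc i) (suc j))
    ≡⟨ cong (λ t → binConv (suc n) (h ∘ suc) + t + suc n * binConv n (λ i j → h (suc i) (suc j))) (binConv-absorb n (h ∘ suc)) ⟩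
  binConv (suc n) (h ∘ suc) + suc n * binConv n (λ i → h (suc (suc i))) + suc n * binConv n (λ i j → h (suc i) (suc j))
    ≡⟨ solve 4 (λ a m x y → a :+ m :* x :+ m :* y := a :+ m :* (x :+ y)) refl
         (binConv (suc n) (h ∘ suc)) (suc n) (binConv n (λ i → h (suc (suc i)))) (binConv n (λ i j → h (suc i) (suc j))) ⟩
  suc (suc n) * binConv (suc n) (h ∘ suc) ∎

binConv≡∑anti : ∀ n (h : ℕ → ℕ → ℕ) → binConv n h ≡ ∑anti n (λ i j → ((i + j) C i) * h i j)
binConv≡∑anti zero    h = sym (+-identityʳ _)
binConv≡∑anti (suc n) h = begin
  binConv n (h ∘ suc) + binConv n (λ i j → h i (suc j))
    ≡⟨ cong₂ _+_ (binConv≡∑anti n (h ∘ suc)) (binConv≡∑anti n (λ i j → h i (suc j))) ⟩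
  ∑anti n left + ∑anti n (λ i j → ((i + j) C i) * h i (suc j))
    ≡⟨ cong (λ t → ∑anti n left + t) (∑anti-cong n (λ i j _ → cong (λ t → (pred t C i) * h i (suc j)) (sym (+-suc i j)))) ⟩
  ∑anti n left + ∑anti n (λ i j → right i (suc j))
    ≡⟨ cong (∑anti n left +_) (+-identityʳ _) ⟨
  ∑anti n left + (∑anti n (λ i j → right i (suc j)) + 0)
    -- The term `right (suc n) 0` vanishes because `binom(n , n + 1) = 0`; adding it completes the
    -- antidiagonal sum of `right`, whose first term can then be split off.
    ≡⟨ cong (λ t → ∑anti n left + (∑anti n (λ i j → right i (suc j)) + t * h (suc n) 0))
         (sym (k>n⇒nCk≡0 {n = n + 0} {k = suc n} (s≤s (≤-reflexive (+-identityʳ n))))) ⟩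
  ∑anti n left + (∑anti n (λ i j → right i (suc j)) + right (suc n) 0)
    ≡⟨ cong (∑anti n left +_) (∑anti-snoc n right) ⟨
  ∑anti n left + (right 0 (suc n) + ∑anti n (right ∘ suc))
    ≡⟨ solve 3 (λ x y z → x :+ (y :+ z) := y :+ (x :+ z)) refl (∑anti n left) (right 0 (suc n)) (∑anti n (right ∘ suc)) ⟩
  right 0 (suc n) + (∑anti n left + ∑anti n (right ∘ suc))
    ≡⟨ cong (right 0 (suc n) +_) (trans (sym (∑anti-+ n left (right ∘ suc))) (∑anti-cong n λ i j _ → pascal i j)) ⟩
  ∑anti (suc n) (λ i j → ((i + j) C i) * h i j) ∎
  where
  left right : ℕ → ℕ → ℕ
  left  i j = ((i + j) C i) * h (suc i) j
  right i j = (pred (i + j) C i) * h i j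
  pascal : ∀ i j → left i j + right (suc i) j ≡ (suc (i + j) C suc i) * h (suc i) j
  pascal i j = trans (sym (*-distribʳ-+ (h (suc i) j) ((i + j) C i) _))
    (cong (_* h (suc i) j) (nCk+nC[k+1]≡[n+1]C[k+1] (i + j) i))

-- The sequence 1, 1, 1, 3, 9, 45, ... The recurrence comes from the logarithmic derivative
-- `B′ / B = 1 / (1 − x²)` of the square root of `(1 + x) / (1 − x)`.
ballots : ℕ → ℕ
ballots zero          = 1
ballots (suc zero)    = 1
ballots (suc (suc n)) = ballots (suc n) + suc n * (n * ballots n)

ballots² : ℕ → ℕ → ℕ
ballots² i j = ballots i * ballots j

binConv-ballots²-suc : ∀ n → binConv (suc n) ballots² ≡ 2 * binConv n (ballots² ∘ suc)
binConv-ballots²-suc n = cong (binConv n (ballots² ∘ suc) +_) (begin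
  binConv n (λ i j → ballots i * ballots (suc j))  ≡⟨ binConv-cong n (λ i j → *-comm (ballots i) (ballots (suc j))) ⟩
  binConv n (λ i j → ballots (suc j) * ballots i)  ≡⟨ binConv-swap n (ballots² ∘ suc) ⟩
  binConv n (ballots² ∘ suc)                ≡⟨ +-identityʳ _ ⟨
  binConv n (ballots² ∘ suc) + 0            ∎)

-- The identity `B′ B = B² + x² B′ B` in degree `n + 1`.
binConv-ballots²-step : ∀ n → binConv (suc n) (ballots² ∘ suc) ≡ binConv (suc n) ballots² + suc n * binConv n (λ i j → i * ballots² i j)
binConv-ballots²-step n = begin
  binConv (suc n) (ballots² ∘ suc)
    ≡⟨ binConv-cong (suc n) (λ i j → ballots-step i (ballots j)) ⟩
  binConv (suc n) (λ i j → ballots i * ballots j + i * (q i * ballots j))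
    ≡⟨ binConv-+ (suc n) ballots² (λ i j → i * (q i * ballots j)) ⟩
  binConv (suc n) ballots² + binConv (suc n) (λ i j → i * (q i * ballots j))
    ≡⟨ cong (binConv (suc n) ballots² +_) (binConv-absorb n (λ i j → q i * ballots j)) ⟩
  binConv (suc n) ballots² + suc n * binConv n (λ i j → i * ballots i * ballots j)
    ≡⟨ cong (λ t → binConv (suc n) ballots² + suc n * t) (binConv-cong n (λ i j → *-assoc i (ballots i) (ballots j))) ⟩
  binConv (suc n) ballots² + suc n * binConv n (λ i j → i * ballots² i j) ∎
  where
  -- The coefficients of an antiderivative of `x B′`. Writing those of `x² B′` as `i * q i` exposes
  -- the factor that `binConv-absorb` takes out.
  q : ℕ → ℕ
  q zero    = 0
  q (suc i) = i * ballots i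
  ballots-step : ∀ i x → ballots (suc i) * x ≡ ballots i * x + i * (q i * x)
  ballots-step zero    x = sym (+-identityʳ _)
  ballots-step (suc i) x = trans (*-distribʳ-+ x (ballots (suc i)) _) (cong (ballots (suc i) * x +_) (*-assoc (suc i) (i * ballots i) x))

-- The recurrence defining ballots says (1 − x²) B′ = B for its exponential generating function B.
-- Hence (1 − x²) (B²)′ = 2 B², which is solved by B² = (1 + x) / (1 − x) = 1 + 2x + 2x² + ⋯.
binConv-ballots²∘suc : ∀ n → binConv n (ballots² ∘ suc) ≡ suc n !
binConv-ballots²∘suc zero          = refl
binConv-ballots²∘suc (suc zero)    = refl
binConv-ballots²∘suc (suc (suc n)) = begin
  binConv (2 + n) (ballots² ∘ suc)
    ≡⟨ binConv-ballots²-step (suc n) ⟩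
  binConv (2 + n) ballots² + (2 + n) * binConv (suc n) (λ i j → i * ballots² i j)
    ≡⟨ cong₂ (λ s t → s + (2 + n) * t) (binConv-ballots²-suc (suc n)) (binConv-absorb n ballots²) ⟩
  2 * binConv (suc n) (ballots² ∘ suc) + (2 + n) * (suc n * binConv n (ballots² ∘ suc))
    ≡⟨ cong₂ (λ s t → 2 * s + (2 + n) * (suc n * t)) (binConv-ballots²∘suc (suc n)) (binConv-ballots²∘suc n) ⟩
  2 * (2 + n) ! + (2 + n) * (suc n * suc n !)
    ≡⟨ solve 2 (λ n p → con 2 :* ((con 2 :+ n) :* p) :+ (con 2 :+ n) :* ((con 1 :+ n) :* p)
                     := (con 3 :+ n) :* ((con 2 :+ n) :* p)) refl n (suc n !) ⟩
  (3 + n) ! ∎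

-- The terms of the binomial convolution of degree m + 2 other than the two outermost ones,
-- for the sequence 1 , γ 0 , γ 1 , …
inner : (ℕ → ℕ) → ℕ → ℕ
inner γ m = ∑anti m (λ i j → ((suc i + suc j) C suc i) * (γ i * γ j))

ballots-recurrence : ∀ m → inner (ballots ∘ suc) m + 2 * ballots (2 + m) ≡ 2 * (2 + m) !
ballots-recurrence m = begin
  inner (ballots ∘ suc) m + 2 * ballots (2 + m)
    ≡⟨ solve 2 (λ x y → x :+ con 2 :* y := (con 1 :* (con 1 :* y)) :+ (x :+ con 1 :* (y :* con 1))) refl (inner (ballots ∘ suc) m) (ballots (2 + m)) ⟩
  h 0 (2 + m) + (inner (ballots ∘ suc) m + 1 * (ballots (2 + m) * ballots 0))
    ≡⟨ cong (λ t → h 0 (2 + m) + (inner (ballots ∘ suc) m + t * (ballots (2 + m) * ballots 0))) (trans (cong (_C (2 + m)) (+-identityʳ (2 + m))) (nCn≡1 (2 + m))) ⟨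
  h 0 (2 + m) + (∑anti m (λ i j → h (suc i) (suc j)) + h (2 + m) 0)
    ≡⟨ cong (h 0 (2 + m) +_) (∑anti-snoc m (h ∘ suc)) ⟨
  ∑anti (2 + m) h
    ≡⟨ binConv≡∑anti (2 + m) ballots² ⟨
  binConv (2 + m) ballots²
    ≡⟨ binConv-ballots²-suc (suc m) ⟩
  2 * binConv (suc m) (ballots² ∘ suc)
    ≡⟨ cong (2 *_) (binConv-ballots²∘suc (suc m)) ⟩
  2 * (2 + m) ! ∎
  where
  h : ℕ → ℕ → ℕ
  h i j = ((i + j) C i) * (ballots i * ballots j)

-- Both sequences satisfy the same recurrence, in which the newest term occurs with the factor 2 and
-- `inner` involves only smaller indices.
#positive≡ballots : ∀ m → #positive m ≡ ballots (suc m)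
#positive≡ballots = <-rec (λ m → #positive m ≡ ballots (suc m)) step
  where
  step : ∀ m → (∀ {k} → k < m → #positive k ≡ ballots (suc k)) → #positive m ≡ ballots (suc m)
  step zero    _  = refl
  step (suc m) ih = *-cancelˡ-≡ _ _ 2 (+-cancelˡ-≡ (inner #positive m) _ _ (begin
    inner #positive m + 2 * #positive (suc m)
      ≡⟨ #positive-recurrence m ⟩
    2 * (2 + m) !
      ≡⟨ ballots-recurrence m ⟨
    inner (ballots ∘ suc) m + 2 * ballots (2 + m)
      ≡⟨ cong (_+ 2 * ballots (2 + m)) (∑anti-cong m (λ { i j refl → cong₂ (λ x y → ((suc i + suc j) C suc i) * (x * y))
           (ih (s≤s (m≤m+n i j))) (ih (s≤s (m≤n+m j i))) })) ⟨
    inner #positive m + 2 * ballots (2 + m) ∎))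

-- Closed forms with double factorials

-- Since `B = (1 + x) (1 − x²)^(−1/2)`, the coefficients pair up, and each odd number enters the
-- product twice in succession.
ballots-ratio : ∀ k → ballots (suc (k * 2)) ≡ suc (k * 2) * ballots (k * 2) × ballots (suc k * 2) ≡ suc (k * 2) * ballots (suc (k * 2))
ballots-ratio zero    = refl , refl
ballots-ratio (suc k) = odd , even
  where
  n = k * 2
  odd : ballots (3 + n) ≡ (3 + n) * ballots (2 + n)
  odd = begin
    ballots (2 + n) + (2 + n) * (suc n * ballots (suc n))  ≡⟨ cong (λ t → ballots (2 + n) + (2 + n) * t) (proj₂ (ballots-ratio k)) ⟨
    (3 + n) * ballots (2 + n)                        ∎
  even : ballots (4 + n) ≡ (3 + n) * ballots (3 + n)
  even = begin
    ballots (3 + n) + (3 + n) * ((2 + n) * ballots (2 + n))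
      ≡⟨ cong (ballots (3 + n) +_) (solve 3 (λ a b x → a :* (b :* x) := b :* (a :* x)) refl (3 + n) (2 + n) (ballots (2 + n))) ⟩
    ballots (3 + n) + (2 + n) * ((3 + n) * ballots (2 + n))
      ≡⟨ cong (λ t → ballots (3 + n) + (2 + n) * t) odd ⟨
    (3 + n) * ballots (3 + n) ∎

ballots-even : ∀ k → ballots (suc k * 2) ≡ ((ℤ.+ suc (k * 2)) !!) ^ 2
-- The index starts at 3 because at 1 the second factor is `(−1)!!`, which a different clause of
-- `_!!` evaluates.
ballots-odd  : ∀ k → ballots (3 + k * 2) ≡ (ℤ.+ (3 + k * 2)) !! * (ℤ.+ suc (k * 2)) !!

ballots-even zero    = refl
ballots-even (suc k) = begin
  ballots (4 + n)                              ≡⟨ proj₂ (ballots-ratio (suc k)) ⟩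
  (3 + n) * ballots (3 + n)                    ≡⟨ cong ((3 + n) *_) (ballots-odd k) ⟩
  (3 + n) * ((3 + n) * x * x)            ≡⟨ solve 2 (λ m x → m :* (m :* x :* x) := m :* x :* (m :* x :* con 1)) refl (3 + n) x ⟩
  ((ℤ.+ (3 + n)) !!) ^ 2                   ∎
  where
  n = k * 2
  x = (ℤ.+ suc n) !!

ballots-odd k = begin
  ballots (3 + n)                              ≡⟨ proj₁ (ballots-ratio (suc k)) ⟩
  (3 + n) * ballots (2 + n)                    ≡⟨ cong ((3 + n) *_) (ballots-even k) ⟩
  (3 + n) * x ^ 2                        ≡⟨ solve 2 (λ m x → m :* (x :* (x :* con 1)) := m :* x :* x) refl (3 + n) x ⟩
  (ℤ.+ (3 + n)) !! * x                     ∎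
  where
  n = k * 2
  x = (ℤ.+ suc n) !!

-- An even number of steps cannot contain exactly one more ascent than descents. Numerically,
-- `b n = n (b (n − 1))` for odd `n`, so the positive permutations already exhaust all extensions.
#dyck-even : ∀ k → #dyck (k * 2) ≡ 0
#dyck-even zero    = refl
#dyck-even (suc k) = +-cancelˡ-≡ (#positive (suc (suc n))) _ _ (begin
  #positive (2 + n) + #dyck (2 + n)   ≡⟨ #positive+#dyck (suc n) ⟩
  (3 + n) * #positive (suc n)     ≡⟨ cong ((3 + n) *_) (#positive≡ballots (suc n)) ⟩
  (3 + n) * ballots (2 + n)     ≡⟨ proj₁ (ballots-ratio (suc k)) ⟨
  ballots (3 + n)               ≡⟨ #positive≡ballots (2 + n) ⟨
  #positive (2 + n)               ≡⟨ +-identityʳ _ ⟨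
  #positive (2 + n) + 0           ∎)
  where n = k * 2

-- For even `n`, `b n = (n − 1) (b (n − 1))`, so exactly one of the `n` copies of `b (n − 1)` is
-- left over.
#dyck-odd : ∀ k → #dyck (suc (k * 2)) ≡ ballots (suc (k * 2))
#dyck-odd k = +-cancelˡ-≡ (#positive (suc n)) _ _ (begin
  #positive (suc n) + #dyck (suc n)              ≡⟨ #positive+#dyck n ⟩
  (2 + n) * #positive n                      ≡⟨ cong ((2 + n) *_) (#positive≡ballots n) ⟩
  ballots (suc n) + suc n * ballots (suc n)      ≡⟨ +-comm (ballots (suc n)) _ ⟩
  suc n * ballots (suc n) + ballots (suc n)      ≡⟨ cong (_+ ballots (suc n)) (proj₂ (ballots-ratio k)) ⟨
  ballots (2 + n) + ballots (suc n)              ≡⟨ cong (_+ ballots (suc n)) (#positive≡ballots (suc n)) ⟨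
  #positive (suc n) + ballots (suc n)              ∎)
  where n = k * 2

-- Codes of permutations

-- The code of a permutation lists, for each position but the first, the rank of its value among the
-- values up to that position.
Code : ℕ → Set
Code zero    = ⊤
Code (suc m) = Code m × Fin (2 + m)

lastRank : ∀ m → Code m → ℕ
lastRank zero    _       = 0
lastRank (suc m) (_ , r) = toℕ r

stepTo : ℕ → ℕ → Step
stepTo s r = if s <ᵇ r then up else down

word : ∀ m → Code m → Word
word zero    _       = []
word (suc m) (c , r) = stepTo (lastRank m c) (toℕ r) ∷ word m c

∑Code : ∀ m → (Code m → ℕ) → ℕ
∑Code zero    φ = φ tt
∑Code (suc m) φ = ∑Code m λ c → sum λ r → φ (c , r)

∑Code-cong : ∀ m {φ ψ : Code m → ℕ} → φ ≗ ψ → ∑Code m φ ≡ ∑Code m ψ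
∑Code-cong zero    φ≗ψ = φ≗ψ tt
∑Code-cong (suc m) φ≗ψ = ∑Code-cong m λ c → sum-cong-≗ λ r → φ≗ψ (c , r)

-- `h` must see the last rank as well as the word, because the next step depends on it; for
-- functions of the word alone the induction would not go through.
∑Code-word-last : ∀ m (h : Word → ℕ → ℕ) →
  ∑Code m (λ c → h (word m c) (lastRank m c))
    ≡ ∑Word m (λ w → ∑< (length w + 1) λ s → byLastRank 1 (const 1) w s * h w s)
∑Code-word-last zero    h = sym (trans (+-identityʳ _) (+-identityʳ _))
∑Code-word-last (suc m) h = begin
  ∑Code m (λ c → ∑< (2 + m) λ r → h (stepTo (lastRank m c) r ∷ word m c) r)
    ≡⟨ ∑Code-word-last m (λ w s → ∑< (2 + m) λ r → h (stepTo s r ∷ w) r) ⟩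
  ∑Word m (λ w → ∑< (length w + 1) λ s → F w s * ∑< (2 + m) λ r → h (stepTo s r ∷ w) r)
    ≡⟨ ∑Word-cong m (λ { w refl → extend w }) ⟩
  ∑Word m (λ w → G (up ∷ w) + G (down ∷ w))
    ≡⟨ ∑Word-+ m _ _ ⟩
  ∑Word (suc m) G ∎
  where
  F : Word → ℕ → ℕ
  F = byLastRank 1 (const 1)
  G : Word → ℕ
  G w = ∑< (length w + 1) λ s → F w s * h w s
  byStep : ∀ w s r → F w s * h (stepTo s r ∷ w) r
    ≡ follows up s r * F w s * h (up ∷ w) r + follows down s r * F w s * h (down ∷ w) r
  byStep w s r with s <ᵇ r
  ... | true  = solve 3 (λ x y z → x :* y := con 1 :* x :* y :+ con 0 :* x :* z) refl (F w s) (h (up ∷ w) r) (h (down ∷ w) r)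
  ... | false = solve 3 (λ x y z → x :* z := con 0 :* x :* y :+ con 1 :* x :* z) refl (F w s) (h (up ∷ w) r) (h (down ∷ w) r)
  extend : ∀ w → ∑< (length w + 1) (λ s → F w s * ∑< (2 + length w) λ r → h (stepTo s r ∷ w) r)
    ≡ G (up ∷ w) + G (down ∷ w)
  extend w = begin
    ∑< n (λ s → F w s * ∑< (2 + length w) λ r → h (stepTo s r ∷ w) r)
      ≡⟨ cong (λ k → ∑< n (λ s → F w s * ∑< (suc k) λ r → h (stepTo s r ∷ w) r)) (+-comm 1 (length w)) ⟩
    ∑< n (λ s → F w s * ∑< (suc n) λ r → h (stepTo s r ∷ w) r)
      ≡⟨ ∑<-cong n (λ s → trans (*-distribˡ-sum {suc n} (F w s) (λ j → h (stepTo s (toℕ j) ∷ w) (toℕ j))) (∑<-cong (suc n) (byStep w s))) ⟩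
    ∑< n (λ s → ∑< (suc n) λ r → term up s r + term down s r)
      -- Summing over the earlier rank `s` first produces `byLastRank` of the extended word.
      ≡⟨ ∑-comm {n} {suc n} (λ i j → term up (toℕ i) (toℕ j) + term down (toℕ i) (toℕ j)) ⟩
    ∑< (suc n) (λ r → ∑< n λ s → term up s r + term down s r)
      ≡⟨ ∑<-cong (suc n) (λ r → trans (∑-distrib-+ {n} (λ i → term up (toℕ i) r) (λ i → term down (toℕ i) r))
           (cong₂ _+_ (collect up r) (collect down r))) ⟩
    ∑< (suc n) (λ r → F (up ∷ w) r * h (up ∷ w) r + F (down ∷ w) r * h (down ∷ w) r)
      ≡⟨ ∑-distrib-+ {suc n} (λ i → F (up ∷ w) (toℕ i) * h (up ∷ w) (toℕ i)) (λ i → F (down ∷ w) (toℕ i) * h (down ∷ w) (toℕ i)) ⟩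
    G (up ∷ w) + G (down ∷ w) ∎
    where
    n = length w + 1
    term : Step → ℕ → ℕ → ℕ
    term x s r = follows x s r * F w s * h (x ∷ w) r
    collect : ∀ x r → ∑< n (λ s → term x s r) ≡ F (x ∷ w) r * h (x ∷ w) r
    collect x r = sym (*-distribʳ-sum {n} (h (x ∷ w) r) (λ i → follows x (toℕ i) r * F w (toℕ i)))

∑Code-word : ∀ m (φ : Word → ℕ) → ∑Code m (φ ∘ word m) ≡ ∑Word m (λ w → perms w * φ w)
∑Code-word m φ = trans (∑Code-word-last m (λ w _ → φ w))
  (∑Word-cong m λ w _ → sym (*-distribʳ-sum {length w + 1} (φ w) _))

Σ-Fin↔Fin-sum : ∀ n (φ : Fin n → ℕ) → Σ (Fin n) (Fin ∘ φ) ↔ Fin (sum φ)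
Σ-Fin↔Fin-sum zero    φ = mk↔ₛ′ (λ ()) (λ ()) (λ ()) (λ ())
Σ-Fin↔Fin-sum (suc n) φ =
  ↔-sym +↔⊎ ↔-∘ ((↔-id _ ⊎-↔ Σ-Fin↔Fin-sum n (φ ∘ Fin.suc)) ↔-∘ headTail)
  where
  headTail : Σ (Fin (suc n)) (Fin ∘ φ) ↔ (Fin (φ Fin.zero) ⊎ Σ (Fin n) (Fin ∘ φ ∘ Fin.suc))
  headTail = mk↔ₛ′
    (λ { (Fin.zero , x) → inj₁ x ; (Fin.suc i , x) → inj₂ (i , x) })
    (λ { (inj₁ x) → Fin.zero , x ; (inj₂ (i , x)) → Fin.suc i , x })
    (λ { (inj₁ x) → refl ; (inj₂ (i , x)) → refl })
    (λ { (Fin.zero , x) → refl ; (Fin.suc i , x) → refl })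

Σ-Code↔Fin-∑Code : ∀ m (φ : Code m → ℕ) → Σ (Code m) (Fin ∘ φ) ↔ Fin (∑Code m φ)
Σ-Code↔Fin-∑Code zero    φ = mk↔ₛ′ proj₂ (tt ,_) (λ _ → refl) (λ _ → refl)
Σ-Code↔Fin-∑Code (suc m) φ = Σ-Code↔Fin-∑Code m (λ c → sum λ r → φ (c , r))
  ↔-∘ (Σ-↔ (↔-id _) (λ {c} → Σ-Fin↔Fin-sum _ (λ r → φ (c , r))) ↔-∘ Σ-assoc)

-- `remove` also closes the gap left by the removed value, so it keeps the relative order of the
-- earlier values; the last value is itself its rank among all values.
encode : ∀ m → Permutation′ (suc m) → Code m
encode zero    σ = tt
encode (suc m) σ = encode m (remove (fromℕ (suc m)) σ) , σ ⟨$⟩ʳ fromℕ (suc m)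

decode : ∀ m → Code m → Permutation′ (suc m)
decode zero    _       = Perm.id
decode (suc m) (c , r) = insert (fromℕ (suc m)) r (decode m c)

remove-cong : ∀ {m} (i : Fin (suc m)) (σ τ : Permutation′ (suc m)) → σ ≈ τ → remove i σ ≈ remove i τ
remove-cong i σ τ σ≈τ k = punchIn-injective (σ ⟨$⟩ʳ i) _ _ (begin
  punchIn (σ ⟨$⟩ʳ i) (remove i σ ⟨$⟩ʳ k)  ≡⟨ punchIn-permute σ i k ⟨
  σ ⟨$⟩ʳ punchIn i k                      ≡⟨ σ≈τ (punchIn i k) ⟩
  τ ⟨$⟩ʳ punchIn i k                      ≡⟨ punchIn-permute τ i k ⟩
  punchIn (τ ⟨$⟩ʳ i) (remove i τ ⟨$⟩ʳ k)  ≡⟨ cong (λ t → punchIn t (remove i τ ⟨$⟩ʳ k)) (σ≈τ i) ⟨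
  punchIn (σ ⟨$⟩ʳ i) (remove i τ ⟨$⟩ʳ k)  ∎)

insert-cong : ∀ {m} (i j : Fin (suc m)) (σ τ : Permutation′ m) → σ ≈ τ → insert i j σ ≈ insert i j τ
insert-cong i j σ τ σ≈τ k with i ≟ k
... | yes _   = refl
... | no  i≢k = cong (punchIn j) (σ≈τ (punchOut i≢k))

insert-at : ∀ {m} (i j : Fin (suc m)) (σ : Permutation′ m) → insert i j σ ⟨$⟩ʳ i ≡ j
insert-at i j σ with i ≟ i
... | yes _   = refl
... | no  i≢i = contradiction refl i≢i

encode-cong : ∀ m {σ τ : Permutation′ (suc m)} → σ ≈ τ → encode m σ ≡ encode m τ
encode-cong zero            σ≈τ = refl
encode-cong (suc m) {σ} {τ} σ≈τ =
  cong₂ _,_ (encode-cong m (remove-cong (fromℕ (suc m)) σ τ σ≈τ)) (σ≈τ (fromℕ (suc m)))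

encode-decode : ∀ m c → encode m (decode m c) ≡ c
encode-decode zero    _       = refl
encode-decode (suc m) (c , r) = cong₂ _,_
  (trans (encode-cong m (remove-insert (fromℕ (suc m)) r (decode m c))) (encode-decode m c))
  (insert-at (fromℕ (suc m)) r (decode m c))

Fin1-unique : ∀ (x y : Fin 1) → x ≡ y
Fin1-unique Fin.zero Fin.zero = refl

decode-encode : ∀ m σ → decode m (encode m σ) ≈ σ
decode-encode zero    σ i = Fin1-unique _ _
decode-encode (suc m) σ i = trans
  (insert-cong (fromℕ (suc m)) (σ ⟨$⟩ʳ fromℕ (suc m)) _ _ (decode-encode m (remove (fromℕ (suc m)) σ)) i)
  (insert-remove (fromℕ (suc m)) σ i)

point : ∀ {b} → b ≡ true → Fin (𝟙 b)
point refl = Fin.zero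

unpoint : ∀ {b} → Fin (𝟙 b) → b ≡ true
unpoint {true} _ = refl

Fin𝟙-unique : ∀ b (x y : Fin (𝟙 b)) → x ≡ y
Fin𝟙-unique true = Fin1-unique

-- `Fin (𝟙 b)` plays the role of the proposition `b ≡ true`, so the codes satisfying `Q` form a sum
-- type whose size is the sum of `𝟙 ∘ Q`. Its elements are determined by the code, matching the
-- equality of permutations that ignores proofs.
number-of-codes : ∀ {m} {P : Pred (Permutation′ (suc m)) _} (Q : Code m → Bool) →
  (∀ σ → P σ ⇔ (Q (encode m σ) ≡ true)) →
  NumberOfPermutationsWith P Is ∑Code m (𝟙 ∘ Q)
number-of-codes {m} {P} Q P⇔Q = record
  { to        = to
  ; from      = from
  ; to-cong   = to-cong
  ; from-cong = λ { refl _ → refl }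
  ; inverse   = (λ {n} y≈ → trans (cong E.to (pair (trans (encode-cong m y≈) (encode-decode m _)) _ _)) (E.strictlyInverseˡ n))
              , λ { {σ , p} refl i → trans (cong (λ z → decode m (proj₁ z) ⟨$⟩ʳ i) (E.strictlyInverseʳ (encode m σ , point (Equivalence.to (P⇔Q σ) p)))) (decode-encode m σ i) }
  }
  where
  module E = Inverse (Σ-Code↔Fin-∑Code m (𝟙 ∘ Q))
  to : Σ (Permutation′ (suc m)) P → Fin (∑Code m (𝟙 ∘ Q))
  to (σ , p) = E.to (encode m σ , point (Equivalence.to (P⇔Q σ) p))
  from : Fin (∑Code m (𝟙 ∘ Q)) → Σ (Permutation′ (suc m)) P
  from n = decode m c , Equivalence.from (P⇔Q (decode m c)) (trans (cong Q (encode-decode m c)) (unpoint x))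
    where
    c = proj₁ (E.from n)
    x = proj₂ (E.from n)
  pair : ∀ {c d} → c ≡ d → (x : Fin (𝟙 (Q c))) (y : Fin (𝟙 (Q d))) → _≡_ {A = Σ (Code m) (Fin ∘ 𝟙 ∘ Q)} (c , x) (d , y)
  pair {c} refl x y = cong (c ,_) (Fin𝟙-unique (Q c) x y)
  to-cong : ∀ {s t : Σ (Permutation′ (suc m)) P} → proj₁ s ≈ proj₁ t → to s ≡ to t
  to-cong σ≈τ = cong E.to (pair (encode-cong m σ≈τ) _ _)

number-of-words : ∀ {m} {P : Pred (Permutation′ (suc m)) _} (Q : Word → Bool) →
  (∀ σ → P σ ⇔ (Q (word m (encode m σ)) ≡ true)) →
  NumberOfPermutationsWith P Is ∑Word m (λ w → perms w * 𝟙 (Q w))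
number-of-words {m} {P} Q P⇔Q = subst (NumberOfPermutationsWith P Is_) (∑Code-word m (𝟙 ∘ Q)) (number-of-codes (Q ∘ word m) P⇔Q)

-- Ascents and descents under removal of the last value

-- With `i` the last value and `j` the rank of the value before it, this and the next lemma turn the
-- comparison of the last two values into the test used by `stepTo`.
toℕ-punchIn-<ᵇ : ∀ {n} (i : Fin (suc n)) j → (toℕ (punchIn i j) <ᵇ toℕ i) ≡ (toℕ j <ᵇ toℕ i)
toℕ-punchIn-<ᵇ Fin.zero    j           = refl
toℕ-punchIn-<ᵇ (Fin.suc i) Fin.zero    = refl
toℕ-punchIn-<ᵇ (Fin.suc i) (Fin.suc j) = toℕ-punchIn-<ᵇ i j

toℕ-<ᵇ-punchIn : ∀ {n} (i : Fin (suc n)) j → (toℕ i <ᵇ toℕ (punchIn i j)) ≡ not (toℕ j <ᵇ toℕ i)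
toℕ-<ᵇ-punchIn Fin.zero    j           = refl
toℕ-<ᵇ-punchIn (Fin.suc i) Fin.zero    = refl
toℕ-<ᵇ-punchIn (Fin.suc i) (Fin.suc j) = toℕ-<ᵇ-punchIn i j

punchIn-<ᵇ-punchIn : ∀ {n} (i : Fin (suc n)) j k →
  (toℕ (punchIn i j) <ᵇ toℕ (punchIn i k)) ≡ (toℕ j <ᵇ toℕ k)
punchIn-<ᵇ-punchIn Fin.zero    j           k           = refl
punchIn-<ᵇ-punchIn (Fin.suc i) Fin.zero    Fin.zero    = refl
punchIn-<ᵇ-punchIn (Fin.suc i) Fin.zero    (Fin.suc k) = refl
punchIn-<ᵇ-punchIn (Fin.suc i) (Fin.suc j) Fin.zero    = refl
punchIn-<ᵇ-punchIn (Fin.suc i) (Fin.suc j) (Fin.suc k) = punchIn-<ᵇ-punchIn i j k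

punchIn-fromℕ : ∀ n (k : Fin n) → punchIn (fromℕ n) k ≡ inject₁ k
punchIn-fromℕ (suc n) Fin.zero    = refl
punchIn-fromℕ (suc n) (Fin.suc k) = cong Fin.suc (punchIn-fromℕ n k)

cnt : ∀ {n} → (Fin n → Bool) → ℕ
cnt b = sum (𝟙 ∘ b)

cnt< : ∀ {n} → ℕ → (Fin n → Bool) → ℕ
cnt< j b = cnt (λ i → (suc (toℕ i) <ᵇ j) ∧ b i)

count-tabulate : ∀ {n} {A : Set} {P : Pred A 0ℓ} (P? : Decidable P) (ι : Fin n → A) →
  count P? (tabulate ι) ≡ cnt (does ∘ P? ∘ ι)
count-tabulate {zero}  P? ι = refl
count-tabulate {suc n} P? ι with does (P? (ι Fin.zero))
... | true  = cong suc (count-tabulate P? (ι ∘ Fin.suc))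
... | false = count-tabulate P? (ι ∘ Fin.suc)

<⇒<ᵇ≡true : ∀ {m n} → m < n → (m <ᵇ n) ≡ true
<⇒<ᵇ≡true {zero}  {suc n} _         = refl
<⇒<ᵇ≡true {suc m} {suc n} (s≤s m<n) = <⇒<ᵇ≡true m<n

≤⇒<ᵇ≡false : ∀ {m n} → n ≤ m → (m <ᵇ n) ≡ false
≤⇒<ᵇ≡false {n = zero}  _         = refl
≤⇒<ᵇ≡false {n = suc n} (s≤s n≤m) = ≤⇒<ᵇ≡false n≤m

cnt<-all : ∀ {n} (b : Fin n → Bool) → cnt< (suc n) b ≡ cnt b
cnt<-all b = sum-cong-≗ λ i → cong (λ t → 𝟙 (t ∧ b i)) (<⇒<ᵇ≡true (toℕ<n i))

cnt-init-last : ∀ {n} (b : Fin (suc n) → Bool) → cnt b ≡ cnt (b ∘ inject₁) + 𝟙 (b (fromℕ n))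
cnt-init-last b = sum-init-last (𝟙 ∘ b)

cnt<-init : ∀ {n} (b : Fin (suc n) → Bool) {j} → j ≤ suc n → cnt< j b ≡ cnt< j (b ∘ inject₁)
cnt<-init {n} b {j} j≤ = begin
  cnt< j b
    ≡⟨ cnt-init-last (λ i → (suc (toℕ i) <ᵇ j) ∧ b i) ⟩
  cnt (λ i → (suc (toℕ (inject₁ i)) <ᵇ j) ∧ b (inject₁ i)) + 𝟙 ((suc (toℕ (fromℕ n)) <ᵇ j) ∧ b (fromℕ n))
    ≡⟨ cong₂ _+_ (sum-cong-≗ λ i → cong (λ t → 𝟙 ((suc t <ᵇ j) ∧ b (inject₁ i))) (toℕ-inject₁ i))
         (cong (λ t → 𝟙 (t ∧ b (fromℕ n))) (trans (cong (λ t → suc t <ᵇ j) (toℕ-fromℕ n)) (≤⇒<ᵇ≡false j≤))) ⟩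
  cnt< j (b ∘ inject₁) + 0
    ≡⟨ +-identityʳ _ ⟩
  cnt< j (b ∘ inject₁) ∎

cnt-cong : ∀ {n} {b c : Fin n → Bool} → b ≗ c → cnt b ≡ cnt c
cnt-cong b≗c = sum-cong-≗ (cong 𝟙 ∘ b≗c)

module _ {m} (σ : Permutation′ (suc m)) where
  asc desc : Fin m → Bool
  asc  i = toℕ (σ ⟨$⟩ʳ inject₁ i) <ᵇ toℕ (σ ⟨$⟩ʳ Fin.suc i)
  desc i = toℕ (σ ⟨$⟩ʳ Fin.suc i) <ᵇ toℕ (σ ⟨$⟩ʳ inject₁ i)

  #ascents≡ : #ascents σ ≡ cnt asc
  #ascents≡ = count-tabulate (ascent? σ) id

  #descents≡ : #descents σ ≡ cnt desc
  #descents≡ = count-tabulate (descent? σ) id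

  #ascents<≡ : ∀ j → (#ascents< j) σ ≡ cnt< j asc
  #ascents<≡ j = count-tabulate (λ i → suc (toℕ i) <? j ×-dec ascent? σ i) id

  #descents<≡ : ∀ j → (#descents< j) σ ≡ cnt< j desc
  #descents<≡ j = count-tabulate (λ i → suc (toℕ i) <? j ×-dec descent? σ i) id

  #ascents<-all : (#ascents< suc m) σ ≡ #ascents σ
  #ascents<-all = trans (#ascents<≡ (suc m)) (trans (cnt<-all asc) (sym #ascents≡))

  #descents<-all : (#descents< suc m) σ ≡ #descents σ
  #descents<-all = trans (#descents<≡ (suc m)) (trans (cnt<-all desc) (sym #descents≡))

  positive⇒#ascents≤#descents : PositiveUpDown σ → #ascents σ ≤ #descents σ
  positive⇒#ascents≤#descents pos = subst₂ _≤_ #ascents<-all #descents<-all (pos (suc m) ≤-refl)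

lastRank-encode : ∀ m (ρ : Permutation′ (suc m)) → lastRank m (encode m ρ) ≡ toℕ (ρ ⟨$⟩ʳ fromℕ m)
lastRank-encode zero    ρ = cong toℕ (Fin1-unique Fin.zero (ρ ⟨$⟩ʳ Fin.zero))
lastRank-encode (suc m) ρ = refl

module _ {m} (σ : Permutation′ (2 + m)) where
  private
    τ = remove (fromℕ (suc m)) σ
    r = σ ⟨$⟩ʳ fromℕ (suc m)

  σ-inject₁ : ∀ k → σ ⟨$⟩ʳ inject₁ k ≡ punchIn r (τ ⟨$⟩ʳ k)
  σ-inject₁ k = trans (cong (σ ⟨$⟩ʳ_) (sym (punchIn-fromℕ (suc m) k))) (punchIn-permute σ (fromℕ (suc m)) k)

  asc-inject₁ : asc σ ∘ inject₁ ≗ asc τ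
  asc-inject₁ i = trans (cong₂ (λ x y → toℕ x <ᵇ toℕ y) (σ-inject₁ (inject₁ i)) (σ-inject₁ (Fin.suc i)))
    (punchIn-<ᵇ-punchIn r _ _)

  desc-inject₁ : desc σ ∘ inject₁ ≗ desc τ
  desc-inject₁ i = trans (cong₂ (λ x y → toℕ x <ᵇ toℕ y) (σ-inject₁ (Fin.suc i)) (σ-inject₁ (inject₁ i)))
    (punchIn-<ᵇ-punchIn r _ _)

  asc-last : asc σ (fromℕ m) ≡ (lastRank m (encode m τ) <ᵇ toℕ r)
  asc-last = trans (cong (λ x → toℕ x <ᵇ toℕ r) (σ-inject₁ (fromℕ m)))
    (trans (toℕ-punchIn-<ᵇ r _) (cong (_<ᵇ toℕ r) (sym (lastRank-encode m τ))))

  desc-last : desc σ (fromℕ m) ≡ not (lastRank m (encode m τ) <ᵇ toℕ r)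
  desc-last = trans (cong (λ x → toℕ r <ᵇ toℕ x) (σ-inject₁ (fromℕ m)))
    (trans (toℕ-<ᵇ-punchIn r _) (cong (λ t → not (t <ᵇ toℕ r)) (sym (lastRank-encode m τ))))

  #ascents-remove : #ascents σ ≡ #ascents τ + 𝟙 (lastRank m (encode m τ) <ᵇ toℕ r)
  #ascents-remove = begin
    #ascents σ                                         ≡⟨ #ascents≡ σ ⟩
    cnt (asc σ)                                        ≡⟨ cnt-init-last (asc σ) ⟩
    cnt (asc σ ∘ inject₁) + 𝟙 (asc σ (fromℕ m))        ≡⟨ cong₂ _+_ (trans (cnt-cong asc-inject₁) (sym (#ascents≡ τ))) (cong 𝟙 asc-last) ⟩
    #ascents τ + 𝟙 (lastRank m (encode m τ) <ᵇ toℕ r)  ∎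

  #descents-remove : #descents σ ≡ #descents τ + 𝟙 (not (lastRank m (encode m τ) <ᵇ toℕ r))
  #descents-remove = begin
    #descents σ                                    ≡⟨ #descents≡ σ ⟩
    cnt (desc σ)                                   ≡⟨ cnt-init-last (desc σ) ⟩
    cnt (desc σ ∘ inject₁) + 𝟙 (desc σ (fromℕ m))  ≡⟨ cong₂ _+_ (trans (cnt-cong desc-inject₁) (sym (#descents≡ τ))) (cong 𝟙 desc-last) ⟩
    #descents τ + 𝟙 (not (lastRank m (encode m τ) <ᵇ toℕ r)) ∎

  #ascents<-remove : ∀ {j} → j ≤ suc m → (#ascents< j) σ ≡ (#ascents< j) τ
  #ascents<-remove {j} j≤ = trans (#ascents<≡ σ j) (trans (cnt<-init (asc σ) j≤)
    (trans (cnt-cong λ i → cong ((suc (toℕ i) <ᵇ j) ∧_) (asc-inject₁ i)) (sym (#ascents<≡ τ j))))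

  #descents<-remove : ∀ {j} → j ≤ suc m → (#descents< j) σ ≡ (#descents< j) τ
  #descents<-remove {j} j≤ = trans (#descents<≡ σ j) (trans (cnt<-init (desc σ) j≤)
    (trans (cnt-cong λ i → cong ((suc (toℕ i) <ᵇ j) ∧_) (desc-inject₁ i)) (sym (#descents<≡ τ j))))

  -- The bounds `j < 2 + m` see every step but the last, so the prefix condition of a Dyck sequence
  -- is positivity after removal of the last value.
  prefixes⇒positive-remove : (∀ j → j < 2 + m → (#ascents< j) σ ≤ (#descents< j) σ) → PositiveUpDown τ
  prefixes⇒positive-remove pre j j≤ = subst₂ _≤_ (#ascents<-remove j≤) (#descents<-remove j≤) (pre j (s≤s j≤))

  positive-remove⇒prefixes : PositiveUpDown τ → ∀ j → j < 2 + m → (#ascents< j) σ ≤ (#descents< j) σ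
  positive-remove⇒prefixes pos j (s≤s j≤) =
    subst₂ _≤_ (sym (#ascents<-remove j≤)) (sym (#descents<-remove j≤)) (pos j j≤)

  positive⇒positive-remove : PositiveUpDown σ → PositiveUpDown τ
  positive⇒positive-remove pos = prefixes⇒positive-remove λ j j< → pos j (<⇒≤ j<)

  positive-extend : PositiveUpDown τ → #ascents σ ≤ #descents σ → PositiveUpDown σ
  positive-extend pos a≤d j j≤ with m≤n⇒m<n∨m≡n j≤
  ... | inj₁ j<   = positive-remove⇒prefixes pos j j<
  ... | inj₂ refl = subst₂ _≤_ (sym (#ascents<-all σ)) (sym (#descents<-all σ)) a≤d

Roomy : ∀ {m} → ℕ → Permutation′ (suc m) → Set
Roomy d σ = PositiveUpDown σ × #ascents σ + d ≤ #descents σ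

positive⇒Roomy : ∀ {m} (σ : Permutation′ (suc m)) → PositiveUpDown σ → Roomy 0 σ
positive⇒Roomy σ pos = pos , subst (_≤ #descents σ) (sym (+-identityʳ _)) (positive⇒#ascents≤#descents σ pos)

module _ {m} (σ : Permutation′ (2 + m)) where
  private
    τ = remove (fromℕ (suc m)) σ

  -- The Boolean stands for the comparison that decides the last step; keeping it abstract allows a
  -- case distinction on it.
  LastStep : Bool → Set
  LastStep b = #ascents σ ≡ #ascents τ + 𝟙 b × #descents σ ≡ #descents τ + 𝟙 (not b)

  Roomy-up⁺ : ∀ {d} → LastStep true → Roomy (suc d) τ → Roomy d σ
  Roomy-up⁺ {d} (a , e) (pos , le) = positive-extend σ pos (≤-trans (m≤m+n _ d) enough) , enough
    where
    enough : #ascents σ + d ≤ #descents σ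
    enough = subst₂ _≤_ (trans (sym (+-assoc (#ascents τ) 1 d)) (cong (_+ d) (sym a)))
      (trans (sym (+-identityʳ _)) (sym e)) le

  Roomy-up⁻ : ∀ {d} → LastStep true → Roomy d σ → Roomy (suc d) τ
  Roomy-up⁻ {d} (a , e) (pos , le) = positive⇒positive-remove σ pos ,
    subst₂ _≤_ (trans (cong (_+ d) a) (+-assoc (#ascents τ) 1 d)) (trans e (+-identityʳ _)) le

  Roomy-down⁺ : ∀ {d} → LastStep false → Roomy (pred d) τ → Roomy d σ
  Roomy-down⁺ {d} (a , e) (pos , le) = positive-extend σ pos (≤-trans (m≤m+n _ d) enough) , enough
    where
    suc-pred-bound : ∀ d → d ≤ pred d + 1
    suc-pred-bound zero    = z≤n
    suc-pred-bound (suc d) = ≤-reflexive (+-comm 1 d)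
    enough : #ascents σ + d ≤ #descents σ
    enough = subst₂ _≤_ (cong (_+ d) (trans (sym (+-identityʳ _)) (sym a))) (sym e)
      (≤-trans (+-monoʳ-≤ (#ascents τ) (suc-pred-bound d))
        (≤-trans (≤-reflexive (sym (+-assoc (#ascents τ) (pred d) 1))) (+-monoˡ-≤ 1 le)))

  Roomy-down⁻ : ∀ {d} → LastStep false → Roomy d σ → Roomy (pred d) τ
  Roomy-down⁻ {d} (a , e) (pos , le) = pos′ , enough d le
    where
    pos′ = positive⇒positive-remove σ pos
    enough : ∀ d → #ascents σ + d ≤ #descents σ → #ascents τ + pred d ≤ #descents τ
    -- Nonnegative surplus after a descent only bounds the surplus before it by -1; the positivity
    -- of `τ` supplies the rest.
    enough zero    _  = subst (_≤ #descents τ) (sym (+-identityʳ _)) (positive⇒#ascents≤#descents τ pos′)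
    enough (suc d) le = +-cancelʳ-≤ 1 _ _ (subst₂ _≤_
      (trans (cong (_+ suc d) (trans a (+-identityʳ _)))
        (trans (cong (#ascents τ +_) (+-comm 1 d)) (sym (+-assoc (#ascents τ) d 1)))) e le)

  module _ (w : Word) (roomy⇔ : ∀ d → (roomy d w ≡ true) ⇔ Roomy d τ) where

    roomy-∷ : ∀ b → LastStep b → ∀ d → (roomy d ((if b then up else down) ∷ w) ≡ true) ⇔ Roomy d σ
    roomy-∷ true  ls d = mk⇔ (Roomy-up⁺ ls ∘ Equivalence.to (roomy⇔ (suc d)))
                             (Equivalence.from (roomy⇔ (suc d)) ∘ Roomy-up⁻ ls)
    roomy-∷ false ls d = mk⇔ (Roomy-down⁺ ls ∘ Equivalence.to (roomy⇔ (pred d)))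
                             (Equivalence.from (roomy⇔ (pred d)) ∘ Roomy-down⁻ ls)

    dyck-∷ : ∀ b → LastStep b → DyckUpDown σ ⇔ (dyck ((if b then up else down) ∷ w) ≡ true)
    -- A descent after the positive `τ` leaves a positive surplus of descents, so the required
    -- excess of ascents is impossible.
    dyck-∷ false (a , e) = mk⇔ (λ (a≡ , pre) → contradiction
      (≤-trans (positive⇒#ascents≤#descents τ (prefixes⇒positive-remove σ pre)) (m≤m+n _ 1))
      (<⇒≱ (≤-reflexive (sym (balance a≡))))) (λ ())
      where
      balance : #ascents σ ≡ suc (#descents σ) → #ascents τ ≡ suc (#descents τ + 1)
      balance a≡ = trans (sym (trans a (+-identityʳ _))) (trans a≡ (cong suc e))
    dyck-∷ true (a , e) = mk⇔ forth back
      where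
      forth : DyckUpDown σ → roomy 0 w ∧ not (roomy 1 w) ≡ true
      forth (a≡ , pre) = cong₂ (λ x y → x ∧ not y)
        (Equivalence.from (roomy⇔ 0) (positive⇒Roomy τ (prefixes⇒positive-remove σ pre)))
        (¬-not λ r → 1+n≰n (subst (_≤ #descents τ) level (proj₂ (Equivalence.to (roomy⇔ 1) r))))
        where
        level : #ascents τ + 1 ≡ suc (#descents τ)
        level = trans (sym a) (trans a≡ (cong suc (trans e (+-identityʳ _))))
      back : roomy 0 w ∧ not (roomy 1 w) ≡ true → DyckUpDown σ
      back r = level , positive-remove⇒prefixes σ pos
        where
        pos = proj₁ (Equivalence.to (roomy⇔ 0) (∧-conicalˡ _ _ r))
        d≤a : #descents τ ≤ #ascents τ
        d≤a = ≮⇒≥ λ a<d → contradiction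
          (Equivalence.from (roomy⇔ 1) (pos , subst (_≤ #descents τ) (+-comm 1 _) a<d))
          (not-¬ (trans (sym (not-involutive _)) (cong not (∧-conicalʳ _ _ r))))
        level : #ascents σ ≡ suc (#descents σ)
        level = begin
          #ascents σ           ≡⟨ a ⟩
          #ascents τ + 1       ≡⟨ +-comm (#ascents τ) 1 ⟩
          suc (#ascents τ)     ≡⟨ cong suc (≤-antisym (positive⇒#ascents≤#descents τ pos) d≤a) ⟩
          suc (#descents τ)    ≡⟨ cong suc (trans e (+-identityʳ _)) ⟨
          suc (#descents σ)    ∎

lastStep : ∀ {m} (σ : Permutation′ (2 + m)) →
  LastStep σ (lastRank m (encode m (remove (fromℕ (suc m)) σ)) <ᵇ toℕ (σ ⟨$⟩ʳ fromℕ (suc m)))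
lastStep σ = #ascents-remove σ , #descents-remove σ

roomy⇔Roomy : ∀ m σ d → (roomy d (word m (encode m σ)) ≡ true) ⇔ Roomy d σ
roomy⇔Roomy zero    σ zero    = mk⇔ (λ _ → (λ _ _ → z≤n) , z≤n) (λ _ → refl)
roomy⇔Roomy zero    σ (suc d) = mk⇔ (λ ()) (λ ())
roomy⇔Roomy (suc m) σ         = roomy-∷ σ _ (roomy⇔Roomy m (remove (fromℕ (suc m)) σ)) _ (lastStep σ)

positive⇔roomy : ∀ {m} (σ : Permutation′ (suc m)) → PositiveUpDown σ ⇔ (roomy 0 (word m (encode m σ)) ≡ true)
positive⇔roomy {m} σ = mk⇔ (Equivalence.from (roomy⇔Roomy m σ 0) ∘ positive⇒Roomy σ)
                           (proj₁ ∘ Equivalence.to (roomy⇔Roomy m σ 0))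

dyck⇔dyck : ∀ {m} (σ : Permutation′ (suc m)) → DyckUpDown σ ⇔ (dyck (word m (encode m σ)) ≡ true)
dyck⇔dyck {zero}  σ = mk⇔ (λ { (() , _) }) (λ ())
dyck⇔dyck {suc m} σ = dyck-∷ σ _ (roomy⇔Roomy m (remove (fromℕ (suc m)) σ)) _ (lastStep σ)

positive-number : ∀ m → NumberOfPermutationsWith (PositiveUpDown {m}) Is #positive m
positive-number m = number-of-words {m} (roomy 0) positive⇔roomy

dyck-number : ∀ m → NumberOfPermutationsWith (DyckUpDown {m}) Is #dyck m
dyck-number m = number-of-words {m} dyck dyck⇔dyck

-- The two parities of n

parity : ∀ n → (Σ ℕ λ k → n ≡ k * 2) ⊎ (Σ ℕ λ k → n ≡ suc (k * 2))
parity zero = inj₁ (0 , refl)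
parity (suc n) with parity n
... | inj₁ (k , n≡) = inj₂ (k , cong suc n≡)
... | inj₂ (k , n≡) = inj₁ (suc k , cong suc n≡)

open ℤ using (+_; _⊖_)

even-case : ∀ k → NumberOfPermutationsWith (PositiveUpDown {suc (k * 2)}) Is (((2 + k * 2) ⊖ 1) !! ^ 2)
                × NumberOfPermutationsWith (DyckUpDown {suc (k * 2)}) Is (((2 + k * 2) ⊖ 1) !! * ((2 + k * 2) ⊖ 3) !!)
even-case k = subst (NumberOfPermutationsWith (PositiveUpDown {suc (k * 2)}) Is_)
                (trans (#positive≡ballots (suc (k * 2))) (ballots-even k)) (positive-number (suc (k * 2)))
            , subst (NumberOfPermutationsWith (DyckUpDown {suc (k * 2)}) Is_)
                (trans (#dyck-odd k) (odd k)) (dyck-number (suc (k * 2)))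
  where
  odd : ∀ k → ballots (suc (k * 2)) ≡ ((2 + k * 2) ⊖ 1) !! * ((2 + k * 2) ⊖ 3) !!
  odd zero    = refl
  odd (suc k) = ballots-odd k

odd-case : ∀ k → NumberOfPermutationsWith (PositiveUpDown {k * 2}) Is ((+ suc (k * 2)) !! * (suc (k * 2) ⊖ 2) !!)
               × NumberOfPermutationsWith (DyckUpDown {k * 2}) Is 0
odd-case k = subst (NumberOfPermutationsWith (PositiveUpDown {k * 2}) Is_)
               (trans (#positive≡ballots (k * 2)) (odd k)) (positive-number (k * 2))
           , subst (NumberOfPermutationsWith (DyckUpDown {k * 2}) Is_)
               (#dyck-even k) (dyck-number (k * 2))
  where
  odd : ∀ k → ballots (suc (k * 2)) ≡ (+ suc (k * 2)) !! * (suc (k * 2) ⊖ 2) !!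
  -- Here `n = 1`, and the second factor is `(−1)!!`, which is 1 by convention.
  odd zero    = refl
  odd (suc k) = ballots-odd k

theorem6 : ∀ (m : ℕ) → let n = suc m in
    ((2 ∣ n → NumberOfPermutationsWith (PositiveUpDown {m}) Is ((n ⊖ 1) !! ^ 2))
    × (2 ∤ n → NumberOfPermutationsWith (PositiveUpDown {m}) Is ((+ n) !! * (n ⊖ 2) !!)))
    × ((2 ∣ n → NumberOfPermutationsWith (DyckUpDown {m}) Is ((n ⊖ 1) !! * (n ⊖ 3) !!))
    × (2 ∤ n → NumberOfPermutationsWith (DyckUpDown {m}) Is 0))
theorem6 m = ((λ 2∣n → proj₁ (even m 2∣n)) , (λ 2∤n → proj₁ (odd m 2∤n)))
           , ((λ 2∣n → proj₂ (even m 2∣n)) , (λ 2∤n → proj₂ (odd m 2∤n)))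
  where
  even : ∀ m → 2 ∣ suc m → NumberOfPermutationsWith (PositiveUpDown {m}) Is ((suc m ⊖ 1) !! ^ 2)
                         × NumberOfPermutationsWith (DyckUpDown {m}) Is ((suc m ⊖ 1) !! * (suc m ⊖ 3) !!)
  even m (divides (suc k) refl) = even-case k
  odd : ∀ m → 2 ∤ suc m → NumberOfPermutationsWith (PositiveUpDown {m}) Is ((+ suc m) !! * (suc m ⊖ 2) !!)
                        × NumberOfPermutationsWith (DyckUpDown {m}) Is 0
  odd m 2∤n with parity m
  ... | inj₁ (k , refl) = odd-case k
  ... | inj₂ (k , refl) = contradiction (divides (suc k) refl) 2∤n
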